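{- Let $\lambda>0$ be a rational number and let $(b_n)_{n\geq 1}$ be the eventually greedy best sequence for $\lambda$ described in the context. Then every sequence of integers $(a_n)_{n\geq 1}$ satisfying \[ 2\leq a_1\leq a_2\leq a_3\leq\cdots,\qquad \sum_{n=1}^{\infty}\frac1{a_n}=\lambda \] has one of the following two properties: \[ \liminf_{n\to\infty}a_n^{2^{ -n}}<\lim_{n\to\infty}b_n^{2^{ -n}} \] or \[ a_n=b_n\quad\text{for all sufficiently large } n . \]
   Context: $\mathbb{N}=\{1,2,\ldots\}$. For $n\geq 1$ let $\mathcal{E}_n^{\leq}=\{(a_1,\ldots,a_n)\in\mathbb{N}^n: 2\leq a_1\leq\cdots\leq a_n\}$, and for real $\lambda>0$ let \[ R_n^{\leq}(\lambda)=\max\Bigl\{\sum_{i=1}^n\frac1{a_i}:\ (a_1,\ldots,a_n)\in\mathcal{E}_n^{\leq},\ \sum_{i=1}^n\frac1{a_i}<\lambda\Bigr\} \] (the maximum is known to exist). A tuple in $\mathcal{E}_n^{\leq}$ attaining this maximum is called a maximizing $n$-term denominator tuple. The sequence $(b_n)$: for every positive rational $\lambda$ the paper constructs an integer $N\geq 1$, a maximizing tuple $(b_1,\ldots,b_N)$ for $R_N^{\leq}(\lambda)$, and an integer $T_0\geq 2$ such that $\lambda=\sum_{i=1}^N 1/b_i+1/T_0$ and such that the following holds. Define $T_{j+1}=T_j(T_j+1)$ for $j\geq 0$ and extend $b_1,\ldots,b_N$ to an infinite sequence by $b_{N+j+1}=T_j+1$ for $j\geq 0$; then $\sum_{n=1}^\infty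 1/b_n=\lambda$ and $\sum_{i=1}^n 1/b_i=R_n^{\leq}(\lambda)$ for every $n\geq N$. The sequence $(b_n)_{n\geq 1}$ so obtained is the eventually greedy best sequence for $\lambda$. The limit $\lim_{n\to\infty}b_n^{2^{ -n}}$ exists and is finite and strictly positive. -}

module Defs where

open import Algebra.Definitions.RawSemiring using () renaming (_^_ to pow)
open import Algebra.Definitions.RawMonoid using (sum)
open import Data.Fin using (Fin; toℕ) renaming (_≤_ to _≤ᶠ_)
open import Data.Integer using (+_)
open import Data.Nat using (ℕ; zero; suc; _+_; _*_; _^_; _≤_; _≥_)
open import Data.Product using (_×_; _,_; ∃-syntax)
open import Data.Rational as ℚ using (ℚ; 0ℚ; _/_; ∣_∣)
import Data.Rational.Properties as ℚ
open import Data.Vec.Functional using (Vector)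
open import Relation.Binary.PropositionalEquality using (_≡_)
open import Relation.Nullary using (¬_)

------------------------------------------------------------------------
-- Extended real numbers

-- x ∈ [-∞,+∞] is represented by the set of all rationals q < x: a
-- downward closed set of rationals without a greatest element.  The
-- empty set is -∞ and the set of all rationals is +∞.  Classically this
-- is the usual extended real line, and that is how it is meant to be
-- used, i.e. in the presence of excluded middle.

record ℝ̄ : Set₁ where
  field
    _∋_    : ℚ → Set
    closed : ∀ {p q} → p ℚ.≤ q → _∋_ q → _∋_ p
    open′  : ∀ {p} → _∋_ p → ∃[ q ] p ℚ.< q × _∋_ q

open ℝ̄ public using (_∋_)

infix 4 _<ᴿ_

_<ᴿ_ : ℝ̄ → ℝ̄ → Set
x <ᴿ y = ∃[ q ] y ∋ q × ¬ (x ∋ q)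

-- The supremum of an arbitrary set of rationals.
sup : (ℚ → Set) → ℝ̄
sup P = record
  { _∋_    = λ q → ∃[ p ] q ℚ.< p × P p
  ; closed = λ { q≤r (p , r<p , Pp) → p , ℚ.≤-<-trans q≤r r<p , Pp }
  ; open′  = λ { (p , q<p , Pp) → let (m , q<m , m<p) = ℚ.<-dense q<p in
                                  m , q<m , p , m<p , Pp }
  }

fromℚ : ℚ → ℝ̄
fromℚ r = sup (_≡ r)

⨆ : (ℕ → ℝ̄) → ℝ̄
⨆ x = sup (λ p → ∃[ n ] x n ∋ p)

⨅ : (ℕ → ℝ̄) → ℝ̄
⨅ x = sup (λ p → ∀ n → x n ∋ p)

liminf : (ℕ → ℝ̄) → ℝ̄
liminf x = ⨆ (λ k → ⨅ (λ n → x (k + n)))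

Eventually : (ℕ → Set) → Set
Eventually P = ∃[ M ] (∀ n → n ≥ M → P n)

-- Convergence in the order topology of [-∞,+∞]; for a finite limit this
-- is ordinary convergence.
record _⟶_ (x : ℕ → ℝ̄) (L : ℝ̄) : Set where
  field
    below : ∀ p → fromℚ p <ᴿ L → Eventually (λ n → fromℚ p <ᴿ x n)
    above : ∀ p → L <ᴿ fromℚ p → Eventually (λ n → x n <ᴿ fromℚ p)

infixr 8 _^ℚ_

_^ℚ_ : ℚ → ℕ → ℚ
_^ℚ_ = pow ℚ.+-*-rawSemiring

-- The nonnegative m-th root of a, for m ≥ 1.
root : ℕ → ℕ → ℝ̄
root m a = sup (λ p → 0ℚ ℚ.≤ p × p ^ℚ m ℚ.≤ + a / 1)

-- n ↦ aₙ^(2⁻ⁿ)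
normalized : (ℕ → ℕ) → (ℕ → ℝ̄)
normalized a n = root (2 ^ n) (a n)

------------------------------------------------------------------------
-- Sums of unit fractions

-- The value at 0 is junk; every denominator considered is at least 2.
1/_ : ℕ → ℚ
1/ zero  = 0ℚ
1/ suc k = + 1 / suc k

∑1/ : ∀ {n} → Vector ℕ n → ℚ
∑1/ a = sum ℚ.+-0-rawMonoid (λ i → 1/ a i)

-- Sequences (aₙ)_{n≥1} are functions ℕ → ℕ whose value at 0 is ignored.
prefix : (ℕ → ℕ) → (n : ℕ) → Vector ℕ n
prefix a n i = a (suc (toℕ i))

SeriesSum : (ℕ → ℕ) → ℚ → Set
SeriesSum a s =
  ∀ ε → 0ℚ ℚ.< ε → Eventually (λ n → ∣ ∑1/ (prefix a n) ℚ.- s ∣ ℚ.< ε)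

------------------------------------------------------------------------
-- Best approximations from below

record ℰ≤ {n} (a : Vector ℕ n) : Set where
  field
    2≤   : ∀ i → 2 ≤ a i
    mono : ∀ {i j : Fin n} → i ≤ᶠ j → a i ≤ a j

record Maximizing (lam : ℚ) {n} (a : Vector ℕ n) : Set where
  field
    admissible : ℰ≤ a
    below      : ∑1/ a ℚ.< lam
    maximal    : (c : Vector ℕ n) → ℰ≤ c → ∑1/ c ℚ.< lam → ∑1/ c ℚ.≤ ∑1/ a

-- IsR≤ lam n r says that r = Rₙ^≤(lam).
IsR≤ : ℚ → ℕ → ℚ → Set
IsR≤ lam n r = ∃[ a ] Maximizing lam {n} a × ∑1/ a ≡ r

T : ℕ → ℕ → ℕ
T T₀ zero    = T₀
T T₀ (suc j) = T T₀ j * (T T₀ j + 1)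

-- Any two sequences satisfying this for the same lam agree from some
-- index on, since their n-th partial sums are eventually both Rₙ^≤(lam).
record EventuallyGreedyBest (lam : ℚ) (b : ℕ → ℕ) : Set where
  field
    N               : ℕ
    1≤N             : 1 ≤ N
    T₀              : ℕ
    2≤T₀            : 2 ≤ T₀
    head-maximizing : Maximizing lam (prefix b N)
    remainder       : lam ≡ ∑1/ (prefix b N) ℚ.+ 1/ T₀
    greedy-tail     : ∀ j → b (suc (N + j)) ≡ T T₀ j + 1
    series          : SeriesSum b lam
    best            : ∀ n → n ≥ N → IsR≤ lam n (∑1/ (prefix b n))

{-# OPTIONS --safe #-}
-- Write λ - 1/a₁ - ⋯ - 1/aₙ = pₙ/Pₙ with Pₙ₊₁ = Pₙ aₙ₊₁, so that the integers
-- pₙ ≥ 1 satisfy pₙ₊₁ = pₙ aₙ₊₁ - Pₙ and hence pₙ Pₙ₊₁ = Pₙ (Pₙ + pₙ₊₁).  Let tₙ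
-- be the reciprocal of the corresponding remainder of b; then tₙ₊₁ = tₙ (tₙ + 1),
-- and since b is best, Pₙ ≤ pₙ tₙ.  If liminf aₙ^(2⁻ⁿ) is not below the limit for
-- b, then for each m eventually aₘ₊ᵢ₊₁ ≥ tₘ^(2ⁱ) =: X, because tₙ^(2⁻ⁿ) increases
-- strictly to its limit; summing the tail, pₘ₊ᵢ (X - 1) ≤ Pₘ₊ᵢ.  Together these
-- bounds make pₙ negligible against every fixed fractional power of tₙ.  Where p
-- attains its minimum M over a late range it must stay constant: a rise would
-- push Pₙ/M below tₙ by a definite factor, and since M Pₙ₊₁ ≤ Pₙ (Pₙ + pₙ₊₁) this
-- deficit is squared at each step, against the lower bound on Pₙ.  Once pₙ = M,
-- the numbers Uₙ = Pₙ/M = aₙ₊₁ - 1 are integers with Uₙ₊₁ = Uₙ (Uₙ + 1) and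
-- Uₙ ≤ tₙ, and Uₙ ≤ tₙ - 1 would again violate the lower bound on Pₙ.

module Submission where

open import Defs
open import Axiom.ExcludedMiddle using (ExcludedMiddle)
open import Data.Empty using (⊥; ⊥-elim)
open import Data.Nat.Tactic.RingSolver using (solve-∀)
open import Data.Product using (_×_; _,_; ∃-syntax; proj₁; proj₂)
open import Function using (case_of_)
open import Level using (0ℓ)
open import Relation.Binary.PropositionalEquality
open import Relation.Nullary using (¬_; yes; no)

-- Iterated squares and minima of natural sequences

module Naturals where

  open import Data.Nat
  open import Data.Nat.Properties

  ^2^-suc : ∀ x i → x ^ 2 ^ suc i ≡ x ^ 2 ^ i * x ^ 2 ^ i
  ^2^-suc x i = trans (^-distribˡ-+-* x (2 ^ i) (2 ^ i + 0))
                      (cong (λ k → x ^ 2 ^ i * x ^ k) (+-identityʳ (2 ^ i)))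

  ^-distribʳ-* : ∀ x y n → (x * y) ^ n ≡ x ^ n * y ^ n
  ^-distribʳ-* x y zero    = refl
  ^-distribʳ-* x y (suc n) = begin-equality
    x * y * (x * y) ^ n      ≡⟨ cong (x * y *_) (^-distribʳ-* x y n) ⟩
    x * y * (x ^ n * y ^ n)  ≡⟨ [m*n]*[o*p]≡[m*o]*[n*p] x y (x ^ n) (y ^ n) ⟩
    x ^ suc n * y ^ suc n    ∎
    where open ≤-Reasoning

  ^2^-≥ : ∀ x .{{_ : NonZero x}} i → x ≤ x ^ 2 ^ i
  ^2^-≥ x i = begin
    x          ≡⟨ ^-identityʳ x ⟨
    x ^ 1      ≤⟨ ^-monoʳ-≤ x (m^n>0 2 i) ⟩
    x ^ 2 ^ i  ∎
    where open ≤-Reasoning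

  n<2^n : ∀ n → n < 2 ^ n
  n<2^n zero    = s≤s z≤n
  n<2^n (suc n) = begin-strict
    suc n            ≤⟨ n<2^n n ⟩
    2 ^ n            <⟨ m<m+n (2 ^ n) (m^n>0 2 n) ⟩
    2 ^ n + 2 ^ n    ≡⟨ cong (2 ^ n +_) (+-identityʳ (2 ^ n)) ⟨
    2 ^ suc n        ∎
    where open ≤-Reasoning

  -- Descent: excluded middle decides whether a smaller value exists, and the bound `v` drops each
  -- time one does.
  minimum : ExcludedMiddle 0ℓ → (f : ℕ → ℕ) → ∃[ n ] (∀ k → f n ≤ f k)
  minimum em f = go (f 0) 0 ≤-refl
    where
    go : ∀ v n → f n ≤ v → ∃[ n ] (∀ k → f n ≤ f k)
    go v n fn≤v with em {∃[ k ] f k < f n}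
    ... | no ∄k = n , λ k → ≮⇒≥ (λ fk<fn → ∄k (k , fk<fn))
    go zero    n fn≤v | yes (k , fk<fn) = ⊥-elim (n≮0 (≤-trans fk<fn fn≤v))
    go (suc v) n fn≤v | yes (k , fk<fn) = go v k (s≤s⁻¹ (≤-trans fk<fn fn≤v))

  -- Doubly exponential bounds for the recurrence T ↦ T (T + 1)

  module Sylvester (T : ℕ → ℕ) (T-suc : ∀ j → T (suc j) ≡ T j * (T j + 1)) where

    T-lower : ∀ m i → T m ^ 2 ^ i ≤ T (m + i)
    T-lower m zero = ≤-reflexive (trans (^-identityʳ (T m)) (cong T (sym (+-identityʳ m))))
    T-lower m (suc i) = begin
      T m ^ 2 ^ suc i             ≡⟨ ^2^-suc (T m) i ⟩
      T m ^ 2 ^ i * T m ^ 2 ^ i   ≤⟨ *-mono-≤ (T-lower m i) (≤-trans (T-lower m i) (m≤m+n _ 1)) ⟩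
      T (m + i) * (T (m + i) + 1) ≡⟨ T-suc (m + i) ⟨
      T (suc (m + i))             ≡⟨ cong T (+-suc m i) ⟨
      T (m + suc i)               ∎
      where open ≤-Reasoning

    -- It is `T + 1` that is dominated by squaring, because T (T + 1) + 1 ≤ (T + 1)².
    T-upper : ∀ m i → T (m + i) + 1 ≤ (T m + 1) ^ 2 ^ i
    T-upper m zero = ≤-reflexive (trans (cong (λ k → T k + 1) (+-identityʳ m)) (sym (^-identityʳ _)))
    T-upper m (suc i) = begin
      T (m + suc i) + 1                       ≡⟨ cong (λ k → T k + 1) (+-suc m i) ⟩
      T (suc (m + i)) + 1                     ≡⟨ cong (_+ 1) (T-suc (m + i)) ⟩
      T (m + i) * (T (m + i) + 1) + 1         ≤⟨ m≤m+n _ (T (m + i)) ⟩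
      T (m + i) * (T (m + i) + 1) + 1 + T (m + i) ≡⟨ square (T (m + i)) ⟩
      (T (m + i) + 1) * (T (m + i) + 1)       ≤⟨ *-mono-≤ (T-upper m i) (T-upper m i) ⟩
      (T m + 1) ^ 2 ^ i * (T m + 1) ^ 2 ^ i   ≡⟨ ^2^-suc (T m + 1) i ⟨
      (T m + 1) ^ 2 ^ suc i                   ∎
      where
      open ≤-Reasoning
      square : ∀ x → x * (x + 1) + 1 + x ≡ (x + 1) * (x + 1)
      square = solve-∀

  -- Loss caused by a rise of the numerator

  -- If p rises from M to Q > M, then P / M loses a factor M / Q against T two
  -- steps later, up to errors of relative size G² / T².
  deficit-after-rise : ∀ {M Q R G T P P′ P″} → 1 ≤ M → M < Q → Q ≤ G → R ≤ G → 2 * G ≤ T →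
         P ≤ M * T → M * P′ ≡ P * (P + Q) → Q * P″ ≡ P′ * (P′ + R) →
         P″ + M * G ≤ M * (T * (T + 1) * (T * (T + 1) + 1))
  deficit-after-rise {M} {Q} {R} {G} {T} {P} {P′} {P″} 1≤M M<Q Q≤G R≤G 2G≤T P≤MT P′-eq P″-eq =
    *-cancelˡ-≤ Q {{>-nonZero 1≤Q}} (begin
      Q * (P″ + M * G)            ≡⟨ *-distribˡ-+ Q P″ (M * G) ⟩
      Q * P″ + Q * (M * G)        ≡⟨ cong (_+ Q * (M * G)) P″-eq ⟩
      P′ * (P′ + R) + Q * (M * G) ≤⟨ +-monoˡ-≤ (Q * (M * G)) (*-mono-≤ P′≤ (+-monoˡ-≤ R P′≤)) ⟩
      V * (V + R) + Q * (M * G)   ≡⟨ expandˡ M Q R G T ⟩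
      M * (M * D) + 2 * (M * Q * (T * T * T))
        + (Q * Q * (T * T) + M * R * (T * T) + Q * R * T + Q * M * G)
                                  ≤⟨ +-monoʳ-≤ (M * (M * D) + 2 * (M * Q * (T * T * T))) small ⟩
      M * (M * D) + 2 * (M * Q * (T * T * T)) + M * D
                                  ≡⟨ regroup M Q T ⟩
      -- The leading term is M² T⁴ against M Q T⁴ in the target. Since Q ≥ M + 1, there is room for
      -- the extra M T⁴ that absorbed the error terms.
      M * (suc M * D) + 2 * (M * Q * (T * T * T))
                                  ≤⟨ +-monoˡ-≤ _ (*-monoʳ-≤ M (*-monoˡ-≤ D M<Q)) ⟩
      M * (Q * D) + 2 * (M * Q * (T * T * T))
                                  ≤⟨ m≤m+n _ (M * Q * (2 * (T * T) + T)) ⟩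
      M * (Q * D) + 2 * (M * Q * (T * T * T)) + M * Q * (2 * (T * T) + T)
                                  ≡⟨ expandʳ M Q T ⟩
      Q * (M * (T * (T + 1) * (T * (T + 1) + 1))) ∎)
    where
    open ≤-Reasoning
    D V : ℕ
    D = T * T * (T * T)
    V = T * (M * T + Q)
    1≤Q : 1 ≤ Q
    1≤Q = ≤-trans 1≤M (<⇒≤ M<Q)
    1≤G : 1 ≤ G
    1≤G = ≤-trans 1≤Q Q≤G
    G≤T : G ≤ T
    G≤T = ≤-trans (m≤m+n G (G + 0)) 2G≤T
    M≤G : M ≤ G
    M≤G = ≤-trans (<⇒≤ M<Q) Q≤G
    1≤T : 1 ≤ T
    1≤T = ≤-trans 1≤G G≤T
    P′≤ : P′ ≤ V
    P′≤ = *-cancelˡ-≤ M {{>-nonZero 1≤M}} (begin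
      M * P′              ≡⟨ P′-eq ⟩
      P * (P + Q)         ≤⟨ *-mono-≤ P≤MT (+-monoˡ-≤ Q P≤MT) ⟩
      M * T * (M * T + Q) ≡⟨ *-assoc M T (M * T + Q) ⟩
      M * V               ∎)
    T≤TT : T ≤ T * T
    T≤TT = m≤m*n T T {{>-nonZero 1≤T}}
    -- Each of the four terms is at most G² T², and (2 G)² T² ≤ T⁴.
    small : Q * Q * (T * T) + M * R * (T * T) + Q * R * T + Q * M * G ≤ M * D
    small = begin
      Q * Q * (T * T) + M * R * (T * T) + Q * R * T + Q * M * G
        ≤⟨ +-mono-≤ (+-mono-≤ (+-mono-≤ (*-monoˡ-≤ (T * T) (*-mono-≤ Q≤G Q≤G))
                                        (*-monoˡ-≤ (T * T) (*-mono-≤ M≤G R≤G)))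
                              (*-mono-≤ (*-mono-≤ Q≤G R≤G) T≤TT))
                    (*-mono-≤ (*-mono-≤ Q≤G M≤G) (≤-trans G≤T T≤TT)) ⟩
      G * G * (T * T) + G * G * (T * T) + G * G * (T * T) + G * G * (T * T)
        ≡⟨ fourfold G T ⟩
      2 * G * (2 * G) * (T * T)
        ≤⟨ *-monoˡ-≤ (T * T) (*-mono-≤ 2G≤T 2G≤T) ⟩
      D
        ≤⟨ m≤n*m D M {{>-nonZero 1≤M}} ⟩
      M * D ∎
      where
      fourfold : ∀ g t → g * g * (t * t) + g * g * (t * t) + g * g * (t * t) + g * g * (t * t)
                       ≡ 2 * g * (2 * g) * (t * t)
      fourfold = solve-∀
    expandˡ : ∀ m q r g t →
      t * (m * t + q) * (t * (m * t + q) + r) + q * (m * g) ≡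
      m * (m * (t * t * (t * t))) + 2 * (m * q * (t * t * t))
        + (q * q * (t * t) + m * r * (t * t) + q * r * t + q * m * g)
    expandˡ = solve-∀
    regroup : ∀ m q t →
      m * (m * (t * t * (t * t))) + 2 * (m * q * (t * t * t)) + m * (t * t * (t * t)) ≡
      m * ((1 + m) * (t * t * (t * t))) + 2 * (m * q * (t * t * t))
    regroup = solve-∀
    expandʳ : ∀ m q t →
      m * (q * (t * t * (t * t))) + 2 * (m * q * (t * t * t)) + m * q * (2 * (t * t) + t) ≡
      q * (m * (t * (t + 1) * (t * (t + 1) + 1)))
    expandʳ = solve-∀

  -- Numerators and denominators of the remainders: growth of the numerators

  -- With F n = 2^2^n, eventually p n ≤ F (3 + n).  The slack g n = F (4 + n) then
  -- satisfies p (n + 1) ≤ g n and g (n + 1) = g n ², and deficit-after-rise asks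
  -- for 2 g (n + 2) ≤ T n; since 2 g (n + 2) ≤ F (7 + n), T 0 ≥ F 7 suffices.
  module Residuals
    (em : ExcludedMiddle 0ℓ)
    (T : ℕ → ℕ) (T-suc : ∀ j → T (suc j) ≡ T j * (T j + 1)) (T-large : 2 ^ 2 ^ 7 ≤ T 0)
    (A p P : ℕ → ℕ)
    (1≤p : ∀ n → 1 ≤ p n)
    (1≤P : ∀ n → 1 ≤ P n)
    (P-suc : ∀ n → P (suc n) ≡ P n * A n)
    (p-suc : ∀ n → p (suc n) + P n ≡ p n * A n)
    (P≤pT : ∀ n → P n ≤ p n * T n)
    -- This is p (X - 1) ≤ P for X = T m ^ 2^i, stated without subtraction.
    (tail : ∀ m → ∃[ i₀ ] (∀ i → i ≥ i₀ → p (m + i) * T m ^ 2 ^ i ≤ P (m + i) + p (m + i)))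
    where

    open Sylvester T T-suc

    -- Eliminates `A n` between the two recurrences, leaving a relation in `p` and `P` alone.
    quadratic : ∀ n → p n * P (suc n) ≡ P n * (P n + p (suc n))
    quadratic n = begin-equality
      p n * P (suc n)         ≡⟨ cong (p n *_) (P-suc n) ⟩
      p n * (P n * A n)       ≡⟨ swap (p n) (P n) (A n) ⟩
      P n * (p n * A n)       ≡⟨ cong (P n *_) (p-suc n) ⟨
      P n * (p (suc n) + P n) ≡⟨ cong (P n *_) (+-comm (p (suc n)) (P n)) ⟩
      P n * (P n + p (suc n)) ∎
      where
      open ≤-Reasoning
      swap : ∀ x y z → x * (y * z) ≡ y * (x * z)
      swap = solve-∀

    F : ℕ → ℕ
    F n = 2 ^ 2 ^ n

    F-mono : ∀ {m n} → m ≤ n → F m ≤ F n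
    F-mono m≤n = ^-monoʳ-≤ 2 (^-monoʳ-≤ 2 m≤n)

    2F≤F : ∀ n → 2 * F n ≤ F (suc n)
    2F≤F n = ≤-trans (*-monoˡ-≤ (F n) (^2^-≥ 2 n)) (≤-reflexive (sym (^2^-suc 2 n)))

    n≤F : ∀ n → n ≤ F n
    n≤F n = <⇒≤ (<-trans (n<2^n n) (n<2^n (2 ^ n)))

    F≤T₀^ : ∀ n → F (7 + n) ≤ T 0 ^ 2 ^ n
    F≤T₀^ n = begin
      2 ^ 2 ^ (7 + n)       ≡⟨ cong (2 ^_) (^-distribˡ-+-* 2 7 n) ⟩
      2 ^ (2 ^ 7 * 2 ^ n)   ≡⟨ ^-*-assoc 2 (2 ^ 7) (2 ^ n) ⟨
      (2 ^ 2 ^ 7) ^ 2 ^ n   ≤⟨ ^-monoˡ-≤ (2 ^ n) T-large ⟩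
      T 0 ^ 2 ^ n           ∎
      where open ≤-Reasoning

    T₀≥2 : 2 ≤ T 0
    T₀≥2 = ≤-trans (^2^-≥ 2 7) T-large

    -- `tail 0` bounds P (n + 1) from below through X² with X = T 0 ^ 2^n, while `quadratic` and
    -- `P≤pT` bound it from above through T n. As T n + 1 ≤ F n · X, the ratio p (n + 1) / p n is at
    -- most about (F n)².
    p-growth : ∃[ i₀ ] (∀ n → n ≥ i₀ → p (suc n) ≤ F (2 + n) * p n)
    p-growth = proj₁ (tail 0) , λ n n≥i₀ → bound n (proj₂ (tail 0) (suc n) (≤-trans n≥i₀ (n≤1+n n)))
      where
      open ≤-Reasoning
      bound : ∀ n → p (suc n) * T 0 ^ 2 ^ suc n ≤ P (suc n) + p (suc n) → p (suc n) ≤ F (2 + n) * p n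
      bound n tail-n = begin
        p′                     ≤⟨ *-cancelʳ-≤ p′ (2 * (F n * F n) * p n) (X * X) {{XX≢0}} cancelled ⟩
        2 * (F n * F n) * p n  ≡⟨ cong (λ k → 2 * k * p n) (^2^-suc 2 n) ⟨
        2 * F (1 + n) * p n    ≤⟨ *-monoˡ-≤ (p n) (2F≤F (1 + n)) ⟩
        F (2 + n) * p n        ∎
        where
        p′ X : ℕ
        p′ = p (suc n)
        X = T 0 ^ 2 ^ n
        1≤X : 1 ≤ X
        1≤X = ≤-trans (≤-trans (n≤1+n 1) T₀≥2) (^2^-≥ (T 0) {{>-nonZero (≤-trans (n≤1+n 1) T₀≥2)}} n)
        XX≢0 : NonZero (X * X)
        XX≢0 = >-nonZero (*-mono-≤ 1≤X 1≤X)
        1≤T₀+0 : 1 ≤ T 0 + 0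
        1≤T₀+0 = ≤-trans (≤-trans (n≤1+n 1) T₀≥2) (m≤m+n (T 0) 0)
        Tn+1≤ : T n + 1 ≤ F n * X
        Tn+1≤ = begin
          T n + 1                ≤⟨ T-upper 0 n ⟩
          (T 0 + 1) ^ 2 ^ n      ≤⟨ ^-monoˡ-≤ (2 ^ n) (+-monoʳ-≤ (T 0) 1≤T₀+0) ⟩
          (2 * T 0) ^ 2 ^ n      ≡⟨ ^-distribʳ-* 2 (T 0) (2 ^ n) ⟩
          F n * X                ∎
        2F≤X : 2 * F n ≤ X
        2F≤X = ≤-trans (2F≤F n) (≤-trans (F-mono {suc n} {7 + n} (m≤n+m (suc n) 6)) (F≤T₀^ n))
        raw : p′ * (X * X) ≤ p n * (T n * T n) + p′ * (T n + 1)
        raw = *-cancelˡ-≤ (p n) {{>-nonZero (1≤p n)}} (begin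
          p n * (p′ * (X * X))               ≡⟨ cong (λ k → p n * (p′ * k)) (^2^-suc (T 0) n) ⟨
          p n * (p′ * T 0 ^ 2 ^ suc n)       ≤⟨ *-monoʳ-≤ (p n) tail-n ⟩
          p n * (P (suc n) + p′)             ≡⟨ *-distribˡ-+ (p n) (P (suc n)) p′ ⟩
          p n * P (suc n) + p n * p′         ≡⟨ cong (_+ p n * p′) (quadratic n) ⟩
          P n * (P n + p′) + p n * p′        ≤⟨ +-monoˡ-≤ (p n * p′) (*-mono-≤ (P≤pT n) (+-monoˡ-≤ p′ (P≤pT n))) ⟩
          p n * T n * (p n * T n + p′) + p n * p′ ≡⟨ factor (p n) (T n) p′ ⟩
          p n * (p n * (T n * T n) + p′ * (T n + 1)) ∎)
          where
          factor : ∀ x t y → x * t * (x * t + y) + x * y ≡ x * (x * (t * t) + y * (t + 1))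
          factor = solve-∀
        Tn≤ : T n ≤ F n * X
        Tn≤ = ≤-trans (m≤m+n (T n) 1) Tn+1≤
        -- Two copies of `raw` are added so that the term in p′ on the right is at most 2 F n X p′ ≤
        -- X² p′, which cancels against one copy on the left.
        doubled : p′ * (X * X) + p′ * (X * X) ≤ 2 * (F n * F n) * p n * (X * X) + p′ * (X * X)
        doubled = begin
          p′ * (X * X) + p′ * (X * X)         ≤⟨ +-mono-≤ raw raw ⟩
          (p n * (T n * T n) + p′ * (T n + 1)) + (p n * (T n * T n) + p′ * (T n + 1))
            ≤⟨ +-mono-≤ half half ⟩
          (p n * (F n * X * (F n * X)) + p′ * (F n * X)) + (p n * (F n * X * (F n * X)) + p′ * (F n * X))
            ≡⟨ collect (p n) (F n) X p′ ⟩
          2 * (F n * F n) * p n * (X * X) + p′ * (2 * F n * X)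
            ≤⟨ +-monoʳ-≤ (2 * (F n * F n) * p n * (X * X)) (*-monoʳ-≤ p′ (*-monoˡ-≤ X 2F≤X)) ⟩
          2 * (F n * F n) * p n * (X * X) + p′ * (X * X) ∎
          where
          half : p n * (T n * T n) + p′ * (T n + 1) ≤ p n * (F n * X * (F n * X)) + p′ * (F n * X)
          half = +-mono-≤ (*-monoʳ-≤ (p n) (*-mono-≤ Tn≤ Tn≤)) (*-monoʳ-≤ p′ Tn+1≤)
          collect : ∀ x f z y → (x * (f * z * (f * z)) + y * (f * z)) + (x * (f * z * (f * z)) + y * (f * z))
                              ≡ 2 * (f * f) * x * (z * z) + y * (2 * f * z)
          collect = solve-∀
        cancelled : p′ * (X * X) ≤ 2 * (F n * F n) * p n * (X * X)
        cancelled = +-cancelʳ-≤ (p′ * (X * X)) _ _ doubled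

    -- The growth factors multiply up to a single F, because F (2 + n)² = F (3 + n). The initial
    -- constant `C` is absorbed once n ≥ C, which is why `n₁` contains it.
    p-bound : ∃[ n₁ ] (∀ n → n ≥ n₁ → p n ≤ F (3 + n))
    p-bound = n₁ , λ n n≥n₁ → begin
        p n                     ≤⟨ subst (λ k → p k ≤ C * F (2 + k))
                                         (m+[n∸m]≡n (≤-trans (m≤m+n i₀ C) n≥n₁)) (scaled (n ∸ i₀)) ⟩
        C * F (2 + n)           ≤⟨ *-monoˡ-≤ (F (2 + n)) (≤-trans (≤-trans (m≤n+m C i₀) n≥n₁)
                                     (≤-trans (n≤F n) (F-mono {n} {2 + n} (m≤n+m n 2)))) ⟩
        F (2 + n) * F (2 + n)   ≡⟨ ^2^-suc 2 (2 + n) ⟨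
        F (3 + n)               ∎
      where
      open ≤-Reasoning
      i₀ C n₁ : ℕ
      i₀ = proj₁ p-growth
      C  = p i₀
      n₁ = i₀ + C
      scaled : ∀ k → p (i₀ + k) ≤ C * F (2 + (i₀ + k))
      scaled zero = ≤-trans (≤-reflexive (cong p (+-identityʳ i₀)))
                            (m≤m*n C (F (2 + (i₀ + 0))) {{m^n≢0 2 (2 ^ (2 + (i₀ + 0)))}})
      scaled (suc k) = begin
        p (i₀ + suc k)                 ≡⟨ cong p (+-suc i₀ k) ⟩
        p (suc n)                      ≤⟨ proj₂ p-growth n (m≤m+n i₀ k) ⟩
        F (2 + n) * p n                ≤⟨ *-monoʳ-≤ (F (2 + n)) (scaled k) ⟩
        F (2 + n) * (C * F (2 + n))    ≡⟨ swap (F (2 + n)) C ⟩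
        C * (F (2 + n) * F (2 + n))    ≡⟨ cong (C *_) (^2^-suc 2 (2 + n)) ⟨
        C * F (3 + n)                  ≡⟨ cong (λ j → C * F (2 + j)) (+-suc i₀ k) ⟨
        C * F (2 + (i₀ + suc k))       ∎
        where
        n : ℕ
        n = i₀ + k
        swap : ∀ x y → x * (y * x) ≡ y * (x * x)
        swap = solve-∀

    -- Persistence of a deficit

    -- Once P + M g falls below M T, it squares at each step and so stays
    -- below the growth rate forced by `tail`.
    no-drop : ∀ M l → 1 ≤ M → (∀ n → n ≥ l → M ≤ p n) → (∀ n → n ≥ l → p n ≤ F (3 + n)) →
              P l + M * F (4 + l) ≤ M * T l → ⊥
    no-drop M l 1≤M M≤p p≤F P-start = <⇒≱ (^2^-≥ 2 (4 + n)) F≤1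
      where
      open ≤-Reasoning
      instance
        M≢0 : NonZero M
        M≢0 = >-nonZero 1≤M
      Y : ℕ → ℕ
      Y i = T l ^ 2 ^ i
      below : ∀ i → P (l + i) + M * F (4 + (l + i)) ≤ M * Y i
      below zero = subst₂ (λ k z → P k + M * F (4 + k) ≤ M * z)
                          (sym (+-identityʳ l)) (sym (^-identityʳ (T l))) P-start
      below (suc i) = subst (λ k → P k + M * F (4 + k) ≤ M * Y (suc i)) (sym (+-suc l i)) (*-cancelˡ-≤ M (begin
        M * (P (suc n) + M * F (5 + n))       ≡⟨ cong (λ z → M * (P (suc n) + M * z)) (^2^-suc 2 (4 + n)) ⟩
        M * (P (suc n) + M * (g * g))         ≡⟨ *-distribˡ-+ M (P (suc n)) (M * (g * g)) ⟩
        M * P (suc n) + M * (M * (g * g))     ≤⟨ +-monoˡ-≤ _ (*-monoˡ-≤ (P (suc n)) (M≤p n (m≤m+n l i))) ⟩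
        p n * P (suc n) + M * (M * (g * g))   ≡⟨ cong (_+ M * (M * (g * g))) (quadratic n) ⟩
        P n * (P n + p (suc n)) + M * (M * (g * g))
          -- Here p (n + 1) ≤ F (4 + n) = g ≤ M g. Adding a further P n · M g then completes the
          -- square of P n + M g.
          ≤⟨ +-monoˡ-≤ _ (*-monoʳ-≤ (P n) (+-monoʳ-≤ (P n)
               (≤-trans (p≤F (suc n) (≤-trans (m≤m+n l i) (n≤1+n n))) (m≤n*m g M)))) ⟩
        P n * (P n + M * g) + M * (M * (g * g))
          ≤⟨ m≤m+n _ (P n * (M * g)) ⟩
        P n * (P n + M * g) + M * (M * (g * g)) + P n * (M * g)
          ≡⟨ square (P n) M g ⟩
        (P n + M * g) * (P n + M * g)         ≤⟨ *-mono-≤ (below i) (below i) ⟩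
        M * Y i * (M * Y i)                   ≡⟨ regroup M (Y i) ⟩
        M * (M * (Y i * Y i))                 ≡⟨ cong (λ z → M * (M * z)) (^2^-suc (T l) i) ⟨
        M * (M * Y (suc i))                   ∎))
        where
        n g : ℕ
        n = l + i
        g = F (4 + n)
        square : ∀ x m g → x * (x + m * g) + m * (m * (g * g)) + x * (m * g) ≡ (x + m * g) * (x + m * g)
        square = solve-∀
        regroup : ∀ m y → m * y * (m * y) ≡ m * (m * (y * y))
        regroup = solve-∀
      i n : ℕ
      i = proj₁ (tail l)
      n = l + i
      -- For y ≥ 1, M (y - 1) ≤ p n (y - 1) ≤ P n ≤ M y - M F (4 + n), so M F (4 + n) ≤ M. The case
      -- split on `y` avoids truncated subtraction.
      squeeze : ∀ y → p n * y ≤ P n + p n → P n + M * F (4 + n) ≤ M * y → F (4 + n) ≤ 1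
      squeeze zero    _     upper = ≤-trans (*-cancelˡ-≤ M (≤-trans (m≤n+m _ (P n)) upper)) z≤n
      squeeze (suc y) lower upper = *-cancelˡ-≤ M (+-cancelˡ-≤ (M * y) _ _ (begin
        M * y + M * F (4 + n)   ≤⟨ +-monoˡ-≤ _ (*-monoˡ-≤ y (M≤p n (m≤m+n l i))) ⟩
        p n * y + M * F (4 + n) ≤⟨ +-monoˡ-≤ _ (+-cancelˡ-≤ (p n) _ _ (begin
          p n + p n * y           ≡⟨ *-suc (p n) y ⟨
          p n * suc y             ≤⟨ lower ⟩
          P n + p n               ≡⟨ +-comm (P n) (p n) ⟩
          p n + P n               ∎)) ⟩
        P n + M * F (4 + n)     ≤⟨ upper ⟩
        M * suc y               ≡⟨ *-suc M y ⟩
        M + M * y               ≡⟨ +-comm M (M * y) ⟩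
        M * y + M               ≡⟨ cong (M * y +_) (*-identityʳ M) ⟨
        M * y + M * 1           ∎))
      F≤1 : F (4 + n) ≤ 1
      F≤1 = squeeze (Y i) (proj₂ (tail l) i ≤-refl) (below i)

    -- Constancy of the numerators

    -- The minimum is taken only over the range where `p-bound` applies, so both properties hold
    -- from its position onwards.
    p-minimum : ∃[ n₁ ] ((∀ n → n ≥ n₁ → p n ≤ F (3 + n)) × (∀ n → n ≥ n₁ → p n₁ ≤ p n))
    p-minimum with p-bound
    ... | n₀ , p≤F with minimum em (λ k → p (n₀ + k))
    ...   | k₀ , min = n₀ + k₀
                     , (λ n n≥ → p≤F n (≤-trans (m≤m+n n₀ k₀) n≥))
                     , (λ n n≥ → subst (λ j → p (n₀ + k₀) ≤ p j)
                                       (m+[n∸m]≡n (≤-trans (m≤m+n n₀ k₀) n≥)) (min (n ∸ n₀)))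

    private
      n₁ M : ℕ
      n₁ = proj₁ p-minimum
      M  = p n₁

    F≤T : ∀ n → F (7 + n) ≤ T n
    F≤T n = ≤-trans (F≤T₀^ n) (T-lower 0 n)

    -- As M is the minimum, only a rise has to be excluded; the induction hypothesis says that such
    -- a rise would start from M exactly.
    p-const : ∀ k → p (n₁ + k) ≡ M
    p-const zero    = cong p (+-identityʳ n₁)
    p-const (suc k) = trans (cong p (+-suc n₁ k)) (≤-antisym (≮⇒≥ rises) (M≤p (suc l) (m≤n⇒m≤1+n l≥n₁)))
      where
      l : ℕ
      l = n₁ + k
      l≥n₁ : l ≥ n₁
      l≥n₁ = m≤m+n n₁ k
      p≤F : ∀ n → n ≥ n₁ → p n ≤ F (3 + n)
      p≤F = proj₁ (proj₂ p-minimum)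
      M≤p : ∀ n → n ≥ n₁ → M ≤ p n
      M≤p = proj₂ (proj₂ p-minimum)
      2+l≥n₁ : 2 + l ≥ n₁
      2+l≥n₁ = m≤n⇒m≤1+n (m≤n⇒m≤1+n l≥n₁)
      T-2+l : T (2 + l) ≡ T l * (T l + 1) * (T l * (T l + 1) + 1)
      T-2+l = trans (T-suc (1 + l)) (cong (λ t → t * (t + 1)) (T-suc l))
      rises : ¬ M < p (suc l)
      rises M<Q = no-drop M (2 + l) (1≤p n₁)
        (λ n n≥ → M≤p n (≤-trans 2+l≥n₁ n≥)) (λ n n≥ → p≤F n (≤-trans 2+l≥n₁ n≥))
        (subst (λ t → P (2 + l) + M * F (6 + l) ≤ M * t) (sym T-2+l)
          -- `no-drop` started at 2 + l needs the slack F (4 + (2 + l)), which fixes G; and 2 G ≤ F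
          -- (7 + l) ≤ T l.
          (deficit-after-rise {G = F (6 + l)} (1≤p n₁) M<Q
            (≤-trans (p≤F (suc l) (m≤n⇒m≤1+n l≥n₁)) (F-mono {4 + l} {6 + l} (m≤n+m (4 + l) 2)))
            (≤-trans (p≤F (2 + l) 2+l≥n₁) (F-mono {5 + l} {6 + l} (n≤1+n (5 + l))))
            (≤-trans (2F≤F (6 + l)) (F≤T l))
            (subst (λ x → P l ≤ x * T l) (p-const k) (P≤pT l))
            (subst (λ x → x * P (suc l) ≡ P l * (P l + p (suc l))) (p-const k) (quadratic l))
            (quadratic (suc l))))

    -- The greedy recurrence once the numerator is constant

    private
      instance
        M≢0 : NonZero M
        M≢0 = >-nonZero (1≤p n₁)

      -- This is the quotient P / M, the reciprocal of the remainder; `A` makes it an integer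
      -- without any division.
      U : ℕ → ℕ
      U k = A (n₁ + k) ∸ 1

    -- For constant p the recurrence `p-suc` reads M + P = M A, so M divides P.
    MA≡ : ∀ k → M * A (n₁ + k) ≡ M + P (n₁ + k)
    MA≡ k = begin-equality
      M * A l               ≡⟨ cong (_* A l) (p-const k) ⟨
      p l * A l             ≡⟨ p-suc l ⟨
      p (suc l) + P l       ≡⟨ cong (_+ P l) (trans (cong p (sym (+-suc n₁ k))) (p-const (suc k))) ⟩
      M + P l               ∎
      where
      open ≤-Reasoning
      l : ℕ
      l = n₁ + k

    A≡U+1 : ∀ k → A (n₁ + k) ≡ U k + 1
    A≡U+1 k = sym (m∸n+n≡m (*-cancelˡ-≤ M (begin
      M * 1                 ≡⟨ *-identityʳ M ⟩
      M                     ≤⟨ m≤m+n M (P (n₁ + k)) ⟩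
      M + P (n₁ + k)        ≡⟨ MA≡ k ⟨
      M * A (n₁ + k)        ∎)))
      where open ≤-Reasoning

    MU≡P : ∀ k → M * U k ≡ P (n₁ + k)
    MU≡P k = +-cancelˡ-≡ M _ _ (begin-equality
      M + M * U k           ≡⟨ *-suc M (U k) ⟨
      M * suc (U k)         ≡⟨ cong (M *_) (+-comm (U k) 1) ⟨
      M * (U k + 1)         ≡⟨ cong (M *_) (A≡U+1 k) ⟨
      M * A (n₁ + k)        ≡⟨ MA≡ k ⟩
      M + P (n₁ + k)        ∎)
      where open ≤-Reasoning

    U-suc : ∀ k → U (suc k) ≡ U k * (U k + 1)
    U-suc k = *-cancelˡ-≡ _ _ M (begin-equality
      M * U (suc k)              ≡⟨ MU≡P (suc k) ⟩
      P (n₁ + suc k)             ≡⟨ cong P (+-suc n₁ k) ⟩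
      P (suc (n₁ + k))           ≡⟨ P-suc (n₁ + k) ⟩
      P (n₁ + k) * A (n₁ + k)    ≡⟨ cong₂ _*_ (sym (MU≡P k)) (A≡U+1 k) ⟩
      M * U k * (U k + 1)        ≡⟨ *-assoc M (U k) (U k + 1) ⟩
      M * (U k * (U k + 1))      ∎)
      where open ≤-Reasoning

    U≤T : ∀ k → U k ≤ T (n₁ + k)
    U≤T k = *-cancelˡ-≤ M (begin
      M * U k                     ≡⟨ MU≡P k ⟩
      P (n₁ + k)                  ≤⟨ P≤pT (n₁ + k) ⟩
      p (n₁ + k) * T (n₁ + k)     ≡⟨ cong (_* T (n₁ + k)) (p-const k) ⟩
      M * T (n₁ + k)              ∎)
      where open ≤-Reasoning

    1≤U : ∀ k → 1 ≤ U k
    1≤U k = n≢0⇒n>0 (λ U≡0 → n>0⇒n≢0 (1≤P (n₁ + k))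
      (trans (sym (MU≡P k)) (trans (cong (M *_) U≡0) (*-zeroʳ M))))

    -- U + 1 < t^(2^k) persists because U (U + 1) + 1 < (U + 1)².
    U₀≮T : ¬ U 0 < T n₁
    -- The start gives only U 0 + 1 ≤ T n₁; the inequality becomes strict after one step, so `tail`
    -- is applied at `suc i`.
    U₀≮T U<T = <⇒≱ (gap i) (*-cancelˡ-≤ M (begin
      M * T n₁ ^ 2 ^ suc i            ≡⟨ cong (_* T n₁ ^ 2 ^ suc i) (p-const (suc i)) ⟨
      p (n₁ + suc i) * T n₁ ^ 2 ^ suc i  ≤⟨ proj₂ (tail n₁) (suc i) (n≤1+n i) ⟩
      P (n₁ + suc i) + p (n₁ + suc i) ≡⟨ cong₂ _+_ (sym (MU≡P (suc i))) (p-const (suc i)) ⟩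
      M * U (suc i) + M               ≡⟨ +-comm _ M ⟩
      M + M * U (suc i)               ≡⟨ *-suc M (U (suc i)) ⟨
      M * suc (U (suc i))             ∎))
      where
      open ≤-Reasoning
      i : ℕ
      i = proj₁ (tail n₁)
      step : ∀ k → suc (U k) ≤ T n₁ ^ 2 ^ k → suc (U (suc k)) < T n₁ ^ 2 ^ suc k
      step k U<X = begin-strict
        suc (U (suc k))               ≡⟨ cong suc (U-suc k) ⟩
        suc (U k * (U k + 1))         <⟨ m<m+n _ (1≤U k) ⟩
        suc (U k * (U k + 1)) + U k   ≡⟨ square (U k) ⟩
        suc (U k) * suc (U k)         ≤⟨ *-mono-≤ U<X U<X ⟩
        T n₁ ^ 2 ^ k * T n₁ ^ 2 ^ k   ≡⟨ ^2^-suc (T n₁) k ⟨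
        T n₁ ^ 2 ^ suc k              ∎
        where
        square : ∀ u → 1 + u * (u + 1) + u ≡ (1 + u) * (1 + u)
        square = solve-∀
      gap : ∀ k → suc (U (suc k)) < T n₁ ^ 2 ^ suc k
      gap zero    = step 0 (≤-trans U<T (≤-reflexive (sym (^-identityʳ (T n₁)))))
      gap (suc k) = step (suc k) (<⇒≤ (gap k))

    U≡T : ∀ k → U k ≡ T (n₁ + k)
    U≡T zero    = trans (≤-antisym (subst (λ j → U 0 ≤ T j) (+-identityʳ n₁) (U≤T 0)) (≮⇒≥ U₀≮T))
                        (cong T (sym (+-identityʳ n₁)))
    U≡T (suc k) = begin-equality
      U (suc k)                     ≡⟨ U-suc k ⟩
      U k * (U k + 1)               ≡⟨ cong (λ u → u * (u + 1)) (U≡T k) ⟩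
      T (n₁ + k) * (T (n₁ + k) + 1) ≡⟨ T-suc (n₁ + k) ⟨
      T (suc (n₁ + k))              ≡⟨ cong T (+-suc n₁ k) ⟨
      T (n₁ + suc k)                ∎
      where open ≤-Reasoning

    eventually-greedy : ∃[ n₀ ] (∀ n → n ≥ n₀ → A n ≡ T n + 1)
    eventually-greedy = n₁ , λ n n≥n₁ →
      subst (λ j → A j ≡ T j + 1) (m+[n∸m]≡n n≥n₁)
        (trans (A≡U+1 (n ∸ n₁)) (cong (_+ 1) (U≡T (n ∸ n₁))))

  -- Fractions whose M-th powers lie between two integers

  crossing : ∀ (f : ℕ → ℕ) {v} → f 0 < v → ∀ K → v ≤ f K → ∃[ k ] f k < v × v ≤ f (suc k)
  crossing f f0<v zero    v≤f0 = ⊥-elim (<⇒≱ f0<v v≤f0)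
  crossing f {v} f0<v (suc K) v≤ with v ≤? f K
  ... | yes v≤fK = crossing f f0<v K v≤fK
  ... | no  v≰fK = K , ≰⇒> v≰fK , v≤

  -- Bernoulli's inequality (1 - 2/(2 + e))^M ≥ 1 - 2 M/(2 + e), with denominators cleared.
  bernoulli : ∀ e M → (2 + e) ^ M * (2 + e) ≤ e ^ M * (2 + e) + 2 * M * (2 + e) ^ M
  bernoulli e zero    = m≤m+n _ 0
  bernoulli e (suc M) = begin
    (2 + e) * c * (2 + e)                             ≡⟨ *-assoc (2 + e) c (2 + e) ⟩
    (2 + e) * (c * (2 + e))                           ≤⟨ *-monoʳ-≤ (2 + e) (bernoulli e M) ⟩
    (2 + e) * (d * (2 + e) + 2 * M * c)               ≡⟨ expand e M c d ⟩
    e * d * (2 + e) + (2 * M * ((2 + e) * c) + 2 * ((2 + e) * d))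
      ≤⟨ +-monoʳ-≤ (e * d * (2 + e)) (+-monoʳ-≤ (2 * M * ((2 + e) * c))
           (*-monoʳ-≤ 2 (*-monoʳ-≤ (2 + e) (^-monoˡ-≤ M (m≤n+m e 2))))) ⟩
    e * d * (2 + e) + (2 * M * ((2 + e) * c) + 2 * ((2 + e) * c))
      ≡⟨ collect e M c d ⟩
    e * d * (2 + e) + 2 * suc M * ((2 + e) * c)       ∎
    where
    open ≤-Reasoning
    c d : ℕ
    c = (2 + e) ^ M
    d = e ^ M
    expand : ∀ e M c d → (2 + e) * (d * (2 + e) + 2 * M * c) ≡
             e * d * (2 + e) + (2 * M * ((2 + e) * c) + 2 * ((2 + e) * d))
    expand = solve-∀
    collect : ∀ e M c d → e * d * (2 + e) + (2 * M * ((2 + e) * c) + 2 * ((2 + e) * c)) ≡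
              e * d * (2 + e) + 2 * (1 + M) * ((2 + e) * c)
    collect = solve-∀

  -- Among multiples of 1/D, let e/D be one just below the M-th root of X, so that (e + 1)/D reaches
  -- it. For D large enough, `bernoulli` keeps the M-th power of (e + 2)/D within X + 1 ≤ Y.
  power-between : ∀ M X Y → 1 ≤ M → 1 ≤ X → X < Y →
                  ∃[ k ] ∃[ D ] 1 ≤ D × X * D ^ M ≤ k ^ M × suc k ^ M ≤ Y * D ^ M
  power-between M@(suc M′) X Y 1≤M 1≤X X<Y =
    suc e , D , 1≤D , proj₂ (proj₂ crossed) ,
    ≤-trans (≮⇒≥ too-large) (*-monoˡ-≤ (D ^ M) X<Y)
    where
    open ≤-Reasoning
    D : ℕ
    -- Chosen so that the Bernoulli error 2 M (2 + e)^M, multiplied by X + 1, is exactly D (2 +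
    -- e)^M, while D < 2 + e.
    D = 2 * M * suc X
    1≤D : 1 ≤ D
    1≤D = s≤s z≤n
    1≤D^M : 1 ≤ D ^ M
    1≤D^M = m^n>0 D M
    crossed : ∃[ k ] k ^ M < X * D ^ M × X * D ^ M ≤ suc k ^ M
    crossed = crossing (_^ M) (*-mono-≤ 1≤X 1≤D^M) (X * D) (begin
      X * D ^ M      ≤⟨ *-monoˡ-≤ (D ^ M) (m≤m*n X (X ^ M′) {{m^n≢0 X M′ {{>-nonZero 1≤X}}}}) ⟩
      X ^ M * D ^ M  ≡⟨ ^-distribʳ-* X D M ⟨
      (X * D) ^ M    ∎)
    e c : ℕ
    e = proj₁ crossed
    c = (2 + e) ^ M
    D≤1+e : D ≤ suc e
    D≤1+e = ≮⇒≥ (λ 1+e<D → <⇒≱ (^-monoˡ-< M 1+e<D)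
      (≤-trans (m≤n*m (D ^ M) X {{>-nonZero 1≤X}}) (proj₂ (proj₂ crossed))))
    too-large : ¬ suc X * D ^ M < c
    too-large D<c = <-irrefl refl (begin-strict
      D * c                                     <⟨ *-monoˡ-< c {{>-nonZero (≤-trans (s≤s z≤n) D<c)}} (s≤s D≤1+e) ⟩
      (2 + e) * c                               ≤⟨ +-cancelˡ-≤ (X * ((2 + e) * c)) _ _ scaled ⟩
      D * c                                     ∎)
      where
      scaled : X * ((2 + e) * c) + (2 + e) * c ≤ X * ((2 + e) * c) + D * c
      scaled = begin
        X * ((2 + e) * c) + (2 + e) * c         ≡⟨ factor X (2 + e) c ⟩
        suc X * (c * (2 + e))                   ≤⟨ *-monoʳ-≤ (suc X) (bernoulli e M) ⟩
        suc X * (e ^ M * (2 + e) + 2 * M * c)   ≤⟨ *-monoʳ-≤ (suc X) (+-monoˡ-≤ (2 * M * c)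
                                                     (*-monoˡ-≤ (2 + e) (<⇒≤ (proj₁ (proj₂ crossed))))) ⟩
        suc X * (X * D ^ M * (2 + e) + 2 * M * c)
                                                ≡⟨ expand X (D ^ M) (2 + e) M c ⟩
        X * ((2 + e) * (suc X * D ^ M)) + D * c ≤⟨ +-monoˡ-≤ (D * c) (*-monoʳ-≤ X (*-monoʳ-≤ (2 + e) (<⇒≤ D<c))) ⟩
        X * ((2 + e) * c) + D * c               ∎
        where
        factor : ∀ x y z → x * (y * z) + y * z ≡ (1 + x) * (z * y)
        factor = solve-∀
        expand : ∀ x d y m c → (1 + x) * (x * d * y + 2 * m * c) ≡ x * (y * ((1 + x) * d)) + 2 * m * (1 + x) * c
        expand = solve-∀

-- Arithmetic of unit fractions in the rationals

module Rationals where

  open Naturals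
  open import Algebra.Bundles using (CommutativeRing)
  open import Algebra.Definitions.RawMonoid using (sum)
  open import Data.Fin using (toℕ)
  open import Data.Integer as ℤ using (+[1+_]; -[1+_])
  import Data.Integer.Properties as ℤ
  import Data.Nat.Coprimality as Coprime
  open import Data.Nat as ℕ using (ℕ; zero; suc)
  import Data.Nat.Properties as ℕ
  open import Data.Rational hiding (1/_; NonZero)
  open import Data.Rational.Properties
  open import Data.Rational.Solver using (module +-*-Solver)
  import Data.Rational.Unnormalised as ℚᵘ
  import Data.Rational.Unnormalised.Properties as ℚᵘ
  open import Algebra.Properties.CommutativeSemiring.Exp
    (CommutativeRing.commutativeSemiring +-*-commutativeRing) using (^-distrib-*)
  open import Algebra.Properties.Semiring.Exp (CommutativeRing.semiring +-*-commutativeRing) using (^-assocʳ)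
  open import Algebra.Properties.Group +-0-group using (∙-cancelʳ)
  open +-*-Solver using (solve; _:+_; _:*_; :-_; _:-_; _:=_)

  ι : ℕ → ℚ
  ι n = ℤ.+ n / 1

  -- `_/_` normalises by a gcd and is stuck on a variable; the explicit form lets sums, products and
  -- comparisons compute.
  ι-mkℚ : ∀ n → ι n ≡ mkℚ (ℤ.+ n) 0 (Coprime.sym (Coprime.1-coprimeTo n))
  ι-mkℚ n = normalize-coprime (Coprime.sym (Coprime.1-coprimeTo n))

  1/-mkℚ : ∀ n → 1/ suc n ≡ mkℚ (ℤ.+ 1) n (Coprime.1-coprimeTo (suc n))
  1/-mkℚ n = normalize-coprime (Coprime.1-coprimeTo (suc n))

  ι-+ : ∀ m n → ι (m ℕ.+ n) ≡ ι m + ι n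
  ι-+ m n rewrite ι-mkℚ m | ι-mkℚ n =
    cong (_/ 1) (sym (cong₂ ℤ._+_ (ℤ.*-identityʳ (ℤ.+ m)) (ℤ.*-identityʳ (ℤ.+ n))))

  ι-* : ∀ m n → ι (m ℕ.* n) ≡ ι m * ι n
  ι-* m n rewrite ι-mkℚ m | ι-mkℚ n = cong (_/ 1) (ℤ.pos-* m n)

  ι-mono-≤ : ∀ {m n} → m ℕ.≤ n → ι m ≤ ι n
  ι-mono-≤ {m} {n} m≤n rewrite ι-mkℚ m | ι-mkℚ n =
    *≤* (ℤ.*-monoʳ-≤-nonNeg (ℤ.+ 1) (ℤ.+≤+ m≤n))

  ι-cancel-≤ : ∀ {m n} → ι m ≤ ι n → m ℕ.≤ n
  ι-cancel-≤ {m} {n} p rewrite ι-mkℚ m | ι-mkℚ n with p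
  ... | *≤* q = ℤ.drop‿+≤+ (ℤ.*-cancelʳ-≤-pos (ℤ.+ m) (ℤ.+ n) (ℤ.+ 1) q)

  ι-cancel-< : ∀ {m n} → ι m < ι n → m ℕ.< n
  ι-cancel-< ιm<ιn = ℕ.≰⇒> (λ n≤m → <-irrefl refl (<-≤-trans ιm<ιn (ι-mono-≤ n≤m)))

  ι-nonNeg : ∀ n → NonNegative (ι n)
  ι-nonNeg n = nonNegative (ι-mono-≤ {0} {n} ℕ.z≤n)

  ι-pos : ∀ {n} → 1 ℕ.≤ n → Positive (ι n)
  ι-pos {n} 1≤n = positive (<-≤-trans (*<* (ℤ.+<+ (ℕ.s≤s ℕ.z≤n))) (ι-mono-≤ {1} {n} 1≤n))

  1/-inverse : ∀ {n} → 1 ℕ.≤ n → 1/ n * ι n ≡ 1ℚ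
  1/-inverse {suc n} _ rewrite 1/-mkℚ n | ι-mkℚ (suc n) =
    *-inverseˡ (mkℚ (ℤ.+ suc n) 0 (Coprime.sym (Coprime.1-coprimeTo (suc n))))

  1/-nonNeg : ∀ n → 0ℚ ≤ 1/ n
  1/-nonNeg zero    = ≤-refl
  1/-nonNeg (suc n) = nonNegative⁻¹ (1/ suc n) {{normalize-nonNeg 1 (suc n)}}

  1/-pos : ∀ {n} → 1 ℕ.≤ n → 0ℚ < 1/ n
  1/-pos {suc n} _ = positive⁻¹ (1/ suc n) {{normalize-pos 1 (suc n)}}

  1/-anti : ∀ {m n} → 1 ℕ.≤ m → m ℕ.≤ n → 1/ n ≤ 1/ m
  1/-anti {suc m} {suc n} _ m≤n rewrite 1/-mkℚ m | 1/-mkℚ n = *≤* (ℤ.*-monoˡ-≤-nonNeg (ℤ.+ 1) (ℤ.+≤+ m≤n))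

  1/-* : ∀ {m n} → 1 ℕ.≤ m → 1 ℕ.≤ n → 1/ (m ℕ.* n) ≡ 1/ m * 1/ n
  1/-* {m} {n} 1≤m 1≤n = begin-equality
    w                            ≡⟨ *-identityʳ w ⟨
    w * 1ℚ                       ≡⟨ cong (w *_) (cong₂ _*_ (1/-inverse 1≤m) (1/-inverse 1≤n)) ⟨
    w * (1/ m * ι m * (1/ n * ι n)) ≡⟨ solve 5 (λ w x y z u → w :* (x :* y :* (z :* u)) := w :* (y :* u) :* (x :* z))
                                                refl w (1/ m) (ι m) (1/ n) (ι n) ⟩
    w * (ι m * ι n) * (1/ m * 1/ n) ≡⟨ cong (λ k → w * k * (1/ m * 1/ n)) (ι-* m n) ⟨
    w * ι (m ℕ.* n) * (1/ m * 1/ n) ≡⟨ cong (_* (1/ m * 1/ n)) (1/-inverse (ℕ.*-mono-≤ 1≤m 1≤n)) ⟩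
    1ℚ * (1/ m * 1/ n)           ≡⟨ *-identityˡ _ ⟩
    1/ m * 1/ n                  ∎
    where
    open ≤-Reasoning
    w : ℚ
    w = 1/ (m ℕ.* n)

  -- The identity behind every telescoping below: after the greedy term 1/(k + 1), a remainder 1/k
  -- is again a unit fraction.
  1/-split : ∀ {k} → 1 ℕ.≤ k → 1/ k ≡ 1/ (k ℕ.+ 1) + 1/ (k ℕ.* (k ℕ.+ 1))
  1/-split {k} 1≤k = begin-equality
    x                         ≡⟨ *-identityʳ x ⟨
    x * 1ℚ                    ≡⟨ cong (x *_) (1/-inverse 1≤k+1) ⟨
    x * (y * ι (k ℕ.+ 1))     ≡⟨ cong (λ z → x * (y * z)) (ι-+ k 1) ⟩
    x * (y * (ι k + 1ℚ))      ≡⟨ solve 4 (λ x y z u → x :* (y :* (z :+ u)) := x :* z :* y :+ x :* y :* u)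
                                          refl x y (ι k) 1ℚ ⟩
    x * ι k * y + x * y * 1ℚ  ≡⟨ cong₂ _+_ (trans (cong (_* y) (1/-inverse 1≤k)) (*-identityˡ y)) (*-identityʳ (x * y)) ⟩
    y + x * y                 ≡⟨ cong (y +_) (1/-* 1≤k 1≤k+1) ⟨
    y + 1/ (k ℕ.* (k ℕ.+ 1))  ∎
    where
    open ≤-Reasoning
    x y : ℚ
    x = 1/ k
    y = 1/ (k ℕ.+ 1)
    1≤k+1 : 1 ℕ.≤ k ℕ.+ 1
    1≤k+1 = ℕ.≤-trans 1≤k (ℕ.m≤m+n k 1)

  -- Fractions are handled through the equation q · ι D ≡ ι k, for q = k / D.

  1/≤⇒≤* : ∀ {q k D n} → 1 ℕ.≤ n → q * ι D ≡ ι k → 1/ n ≤ q → D ℕ.≤ k ℕ.* n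
  1/≤⇒≤* {q} {k} {D} {n} 1≤n q≡k/D 1/n≤q = ι-cancel-≤ (begin
    ι D                  ≡⟨ *-identityˡ (ι D) ⟨
    1ℚ * ι D             ≡⟨ cong (_* ι D) (1/-inverse 1≤n) ⟨
    1/ n * ι n * ι D     ≤⟨ *-monoʳ-≤-nonNeg (ι D) {{ι-nonNeg D}} (*-monoʳ-≤-nonNeg (ι n) {{ι-nonNeg n}} 1/n≤q) ⟩
    q * ι n * ι D        ≡⟨ solve 3 (λ x y z → x :* y :* z := x :* z :* y) refl q (ι n) (ι D) ⟩
    q * ι D * ι n        ≡⟨ cong (_* ι n) q≡k/D ⟩
    ι k * ι n            ≡⟨ ι-* k n ⟨
    ι (k ℕ.* n)          ∎)
    where open ≤-Reasoning

  ≤1/⇒*≤ : ∀ {q k D n} → 1 ℕ.≤ n → q * ι D ≡ ι k → q ≤ 1/ n → k ℕ.* n ℕ.≤ D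
  ≤1/⇒*≤ {q} {k} {D} {n} 1≤n q≡k/D q≤1/n = ι-cancel-≤ (begin
    ι (k ℕ.* n)          ≡⟨ ι-* k n ⟩
    ι k * ι n            ≡⟨ cong (_* ι n) q≡k/D ⟨
    q * ι D * ι n        ≡⟨ solve 3 (λ x y z → x :* z :* y := x :* y :* z) refl q (ι n) (ι D) ⟩
    q * ι n * ι D        ≤⟨ *-monoʳ-≤-nonNeg (ι D) {{ι-nonNeg D}} (*-monoʳ-≤-nonNeg (ι n) {{ι-nonNeg n}} q≤1/n) ⟩
    1/ n * ι n * ι D     ≡⟨ cong (_* ι D) (1/-inverse 1≤n) ⟩
    1ℚ * ι D             ≡⟨ *-identityˡ (ι D) ⟩
    ι D                  ∎)
    where open ≤-Reasoning

  -- Powers of rationals and representation as fractions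

  ^ℚ-nonNeg : ∀ {x} n → 0ℚ ≤ x → 0ℚ ≤ x ^ℚ n
  ^ℚ-nonNeg zero    _   = ι-mono-≤ {0} {1} ℕ.z≤n
  ^ℚ-nonNeg {x} (suc n) 0≤x = begin
    0ℚ          ≡⟨ *-zeroʳ x ⟨
    x * 0ℚ      ≤⟨ *-monoˡ-≤-nonNeg x {{nonNegative 0≤x}} (^ℚ-nonNeg n 0≤x) ⟩
    x * x ^ℚ n  ∎
    where open ≤-Reasoning

  ^ℚ-mono : ∀ {x y} n → 0ℚ ≤ x → x ≤ y → x ^ℚ n ≤ y ^ℚ n
  ^ℚ-mono zero    _   _   = ≤-refl
  ^ℚ-mono {x} {y} (suc n) 0≤x x≤y = begin
    x * x ^ℚ n  ≤⟨ *-monoˡ-≤-nonNeg x {{nonNegative 0≤x}} (^ℚ-mono n 0≤x x≤y) ⟩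
    x * y ^ℚ n  ≤⟨ *-monoʳ-≤-nonNeg (y ^ℚ n) {{nonNegative (^ℚ-nonNeg n (≤-trans 0≤x x≤y))}} x≤y ⟩
    y * y ^ℚ n  ∎
    where open ≤-Reasoning

  ι-^ : ∀ m n → ι (m ℕ.^ n) ≡ ι m ^ℚ n
  ι-^ m zero    = refl
  ι-^ m (suc n) = trans (ι-* m (m ℕ.^ n)) (cong (ι m *_) (ι-^ m n))

  fraction-^ : ∀ {q k D} n → q * ι D ≡ ι k → q ^ℚ n * ι (D ℕ.^ n) ≡ ι (k ℕ.^ n)
  fraction-^ {q} {k} {D} n q≡k/D = begin-equality
    q ^ℚ n * ι (D ℕ.^ n)  ≡⟨ cong (q ^ℚ n *_) (ι-^ D n) ⟩
    q ^ℚ n * ι D ^ℚ n     ≡⟨ ^-distrib-* q (ι D) n ⟨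
    (q * ι D) ^ℚ n        ≡⟨ cong (_^ℚ n) q≡k/D ⟩
    ι k ^ℚ n              ≡⟨ ι-^ k n ⟨
    ι (k ℕ.^ n)           ∎
    where open ≤-Reasoning

  ι≤fraction : ∀ {q k D X} → 1 ℕ.≤ D → q * ι D ≡ ι k → X ℕ.* D ℕ.≤ k → ι X ≤ q
  ι≤fraction {q} {k} {D} {X} 1≤D q≡k/D XD≤k = *-cancelʳ-≤-pos (ι D) {{ι-pos 1≤D}} (begin
    ι X * ι D      ≡⟨ ι-* X D ⟨
    ι (X ℕ.* D)    ≤⟨ ι-mono-≤ XD≤k ⟩
    ι k            ≡⟨ q≡k/D ⟨
    q * ι D        ∎)
    where open ≤-Reasoning

  fraction≤ι : ∀ {q k D X} → 1 ℕ.≤ D → q * ι D ≡ ι k → k ℕ.≤ X ℕ.* D → q ≤ ι X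
  fraction≤ι {q} {k} {D} {X} 1≤D q≡k/D k≤XD = *-cancelʳ-≤-pos (ι D) {{ι-pos 1≤D}} (begin
    q * ι D        ≡⟨ q≡k/D ⟩
    ι k            ≤⟨ ι-mono-≤ k≤XD ⟩
    ι (X ℕ.* D)    ≡⟨ ι-* X D ⟩
    ι X * ι D      ∎)
    where open ≤-Reasoning

  positive-fraction : ∀ {q} → 0ℚ < q → ∃[ k ] ∃[ D ] 1 ℕ.≤ D × q * ι D ≡ ι k
  positive-fraction {mkℚ +[1+ k ] d c} _ = suc k , suc d , ℕ.s≤s ℕ.z≤n , toℚᵘ-injective (begin
    toℚᵘ (q * ι (suc d))                        ≈⟨ toℚᵘ-homo-* q (ι (suc d)) ⟩
    toℚᵘ q ℚᵘ.* toℚᵘ (ι (suc d))                ≡⟨ cong (λ x → toℚᵘ q ℚᵘ.* toℚᵘ x) (ι-mkℚ (suc d)) ⟩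
    ℚᵘ.mkℚᵘ +[1+ k ] d ℚᵘ.* ℚᵘ.mkℚᵘ +[1+ d ] 0  ≈⟨ ℚᵘ.*≡* (cong ℤ.+_ (cross (suc k) (suc d))) ⟩
    ℚᵘ.mkℚᵘ +[1+ k ] 0                          ≡⟨ cong toℚᵘ (ι-mkℚ (suc k)) ⟨
    toℚᵘ (ι (suc k))                            ∎)
    where
    open ℚᵘ.≃-Reasoning
    q : ℚ
    q = mkℚ +[1+ k ] d c
    cross : ∀ x y → x ℕ.* y ℕ.* 1 ≡ x ℕ.* (y ℕ.* 1)
    cross = solve-∀
  positive-fraction {mkℚ (ℤ.+ 0) d c} 0<q with positive 0<q
  ... | ()
  positive-fraction {mkℚ -[1+ k ] d c} 0<q with positive 0<q
  ... | ()

  -- `sum` unfolds from the front, whereas prefixes grow at the back.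
  sum-last : ∀ (f : ℕ → ℚ) n →
             sum +-0-rawMonoid {suc n} (λ i → f (toℕ i)) ≡ sum +-0-rawMonoid {n} (λ i → f (toℕ i)) + f n
  sum-last f zero    = +-comm (f 0) 0ℚ
  sum-last f (suc n) = trans (cong (f 0 +_) (sum-last (λ k → f (suc k)) n)) (sym (+-assoc (f 0) _ (f (suc n))))

  ∑1/-suc : ∀ a n → ∑1/ (prefix a (suc n)) ≡ ∑1/ (prefix a n) + 1/ a (suc n)
  ∑1/-suc a = sum-last (λ k → 1/ a (suc k))

  x≤x+y : ∀ x {y} → 0ℚ ≤ y → x ≤ x + y
  x≤x+y x 0≤y = ≤-trans (≤-reflexive (sym (+-identityʳ x))) (+-monoʳ-≤ x 0≤y)

  x<x+y : ∀ x {y} → 0ℚ < y → x < x + y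
  x<x+y x 0<y = ≤-<-trans (≤-reflexive (sym (+-identityʳ x))) (+-monoʳ-< x 0<y)

  x<y⇒0<y-x : ∀ {x y} → x < y → 0ℚ < y - x
  x<y⇒0<y-x {x} {y} x<y = ≤-<-trans (≤-reflexive (sym (+-inverseʳ x))) (+-monoˡ-< (- x) x<y)

  -- Remainders of a series of unit fractions

  module Series
    (lam : ℚ) (0<lam : 0ℚ < lam) (a : ℕ → ℕ) (2≤a : ∀ n → 2 ℕ.≤ a (suc n)) (series : SeriesSum a lam)
    where

    S r : ℕ → ℚ
    S n = ∑1/ (prefix a n)
    r n = lam - S n

    1≤a : ∀ n → 1 ℕ.≤ a (suc n)
    1≤a n = ℕ.≤-trans (ℕ.n≤1+n 1) (2≤a n)

    S-mono : ∀ n k → S n ≤ S (n ℕ.+ k)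
    S-mono n zero    = ≤-reflexive (cong S (sym (ℕ.+-identityʳ n)))
    S-mono n (suc k) = begin
      S n                                 ≤⟨ S-mono n k ⟩
      S (n ℕ.+ k)                         ≤⟨ x≤x+y (S (n ℕ.+ k)) (1/-nonNeg (a (suc (n ℕ.+ k)))) ⟩
      S (n ℕ.+ k) + 1/ a (suc (n ℕ.+ k))  ≡⟨ ∑1/-suc a (n ℕ.+ k) ⟨
      S (suc (n ℕ.+ k))                   ≡⟨ cong S (ℕ.+-suc n k) ⟨
      S (n ℕ.+ suc k)                     ∎
      where open ≤-Reasoning

    -- If S n reached `lam`, the next positive term would put S (n + 1) above it by some δ, and all
    -- later sums would stay at least δ away.
    S<lam : ∀ n → S n < lam
    S<lam n = ≰⇒> λ lam≤S →
      let
        0<δ = x<y⇒0<y-x (≤-<-trans lam≤S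
                (<-≤-trans (x<x+y (S n) (1/-pos (1≤a n))) (≤-reflexive (sym (∑1/-suc a n)))))
        M , close = series (S (suc n) - lam) 0<δ
        δ≤d = +-monoˡ-≤ (- lam) (S-mono (suc n) M)
      in <-irrefl refl (≤-<-trans δ≤d
           (≤-<-trans (≤-reflexive (sym (0≤p⇒∣p∣≡p (≤-trans (<⇒≤ 0<δ) δ≤d))))
                      (close (suc n ℕ.+ M) (ℕ.m≤n+m M (suc n)))))

    r-suc : ∀ n → r n ≡ 1/ a (suc n) + r (suc n)
    r-suc n = trans (solve 3 (λ l s x → l :- s := x :+ (l :- (s :+ x))) refl lam (S n) (1/ a (suc n)))
                    (cong (λ s → 1/ a (suc n) + (lam - s)) (sym (∑1/-suc a n)))

    0<r : ∀ n → 0ℚ < r n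
    0<r n = x<y⇒0<y-x (S<lam n)

    r→0 : ∀ ε → 0ℚ < ε → Eventually (λ n → r n < ε)
    r→0 ε 0<ε = let M , close = series ε 0<ε in M , λ n n≥M → begin-strict
      r n            ≡⟨ 0≤p⇒∣p∣≡p (<⇒≤ (0<r n)) ⟨
      ∣ r n ∣        ≡⟨ ∣-p∣≡∣p∣ (r n) ⟨
      ∣ - r n ∣      ≡⟨ cong ∣_∣ (solve 2 (λ l s → :- (l :- s) := s :- l) refl lam (S n)) ⟩
      ∣ S n - lam ∣  <⟨ close n n≥M ⟩
      ε              ∎
      where open ≤-Reasoning

    private
      p₀ P₀ : ℕ
      p₀ = proj₁ (positive-fraction 0<lam)
      P₀ = proj₁ (proj₂ (positive-fraction 0<lam))

    P : ℕ → ℕ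
    P zero    = P₀
    P (suc n) = P n ℕ.* a (suc n)

    -- Multiplying r n = 1/a + r (n + 1) by P n · a gives the new numerator k a - P n. The
    -- subtraction is not truncated because r (n + 1) > 0.
    numerator-suc : ∀ n k → r n * ι (P n) ≡ ι k →
                    ∃[ k′ ] r (suc n) * ι (P (suc n)) ≡ ι k′ × k′ ℕ.+ P n ≡ k ℕ.* a (suc n)
    numerator-suc n k rP≡k = k ℕ.* x ℕ.∸ P n , ∙-cancelʳ (ι (P n)) _ _ eq , ℕ.m∸n+n≡m P≤kx
      where
      open ≤-Reasoning
      x : ℕ
      x = a (suc n)
      sum-eq : r (suc n) * ι (P n ℕ.* x) + ι (P n) ≡ ι (k ℕ.* x)
      sum-eq = begin-equality
        r (suc n) * ι (P n ℕ.* x) + ι (P n)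
          ≡⟨ cong₂ (λ u v → r (suc n) * u + v) (ι-* (P n) x)
                   (trans (sym (*-identityˡ (ι (P n)))) (cong (_* ι (P n)) (sym (1/-inverse (1≤a n))))) ⟩
        r (suc n) * (ι (P n) * ι x) + 1/ x * ι x * ι (P n)
          ≡⟨ solve 4 (λ r p x y → r :* (p :* x) :+ y :* x :* p := (y :+ r) :* p :* x)
                     refl (r (suc n)) (ι (P n)) (ι x) (1/ x) ⟩
        (1/ x + r (suc n)) * ι (P n) * ι x  ≡⟨ cong (λ u → u * ι (P n) * ι x) (r-suc n) ⟨
        r n * ι (P n) * ι x                 ≡⟨ cong (_* ι x) rP≡k ⟩
        ι k * ι x                           ≡⟨ ι-* k x ⟨
        ι (k ℕ.* x)                         ∎
      P≤kx : P n ℕ.≤ k ℕ.* x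
      P≤kx = ι-cancel-≤ (begin
        ι (P n)                             ≤⟨ x≤x+y (ι (P n)) 0≤rP ⟩
        ι (P n) + r (suc n) * ι (P n ℕ.* x) ≡⟨ trans (+-comm (ι (P n)) _) sum-eq ⟩
        ι (k ℕ.* x)                         ∎)
        where
        0≤rP : 0ℚ ≤ r (suc n) * ι (P n ℕ.* x)
        0≤rP = ≤-trans (≤-reflexive (sym (*-zeroˡ (ι (P n ℕ.* x)))))
                       (*-monoʳ-≤-nonNeg (ι (P n ℕ.* x)) {{ι-nonNeg (P n ℕ.* x)}} (<⇒≤ (0<r (suc n))))
      eq : r (suc n) * ι (P n ℕ.* x) + ι (P n) ≡ ι (k ℕ.* x ℕ.∸ P n) + ι (P n)
      eq = trans sum-eq (trans (cong ι (sym (ℕ.m∸n+n≡m P≤kx))) (ι-+ (k ℕ.* x ℕ.∸ P n) (P n)))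

    numerator : ∀ n → ∃[ k ] r n * ι (P n) ≡ ι k
    numerator zero    = p₀ , trans (cong (_* ι P₀) (+-identityʳ lam))
                                   (proj₂ (proj₂ (proj₂ (positive-fraction 0<lam))))
    numerator (suc n) = let k , rP≡k = numerator n
                            k′ , rP≡k′ , _ = numerator-suc n k rP≡k
                        in k′ , rP≡k′

    p : ℕ → ℕ
    p n = proj₁ (numerator n)

    1≤P : ∀ n → 1 ℕ.≤ P n
    1≤P zero    = proj₁ (proj₂ (proj₂ (positive-fraction 0<lam)))
    1≤P (suc n) = ℕ.*-mono-≤ (1≤P n) (1≤a n)

    1≤p : ∀ n → 1 ℕ.≤ p n
    1≤p n = ι-cancel-< {0} {p n} (begin-strict
      0ℚ               ≡⟨ *-zeroˡ (ι (P n)) ⟨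
      0ℚ * ι (P n)     <⟨ *-monoˡ-<-pos (ι (P n)) {{ι-pos (1≤P n)}} (0<r n) ⟩
      r n * ι (P n)    ≡⟨ proj₂ (numerator n) ⟩
      ι (p n)          ∎)
      where open ≤-Reasoning

    p-suc : ∀ n → p (suc n) ℕ.+ P n ≡ p n ℕ.* a (suc n)
    p-suc n = proj₂ (proj₂ (numerator-suc n (p n) (proj₂ (numerator n))))

    -- The sum of 1/X^(2^i) over all i is at most 1/(X - 1), as comparison with K i = X^(2^i) - 1
    -- and `1/-split` shows. So r j ≤ 1/(X - 1), and denominators are cleared.
    tail-bound : ∀ j X → 2 ℕ.≤ X → (∀ i → X ℕ.^ 2 ℕ.^ i ℕ.≤ a (suc (j ℕ.+ i))) →
                 p j ℕ.* X ℕ.≤ P j ℕ.+ p j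
    tail-bound j X@(suc k) (ℕ.s≤s 1≤k) X^≤a = begin
      p j ℕ.* suc k        ≡⟨ ℕ.*-suc (p j) k ⟩
      p j ℕ.+ p j ℕ.* k    ≤⟨ ℕ.+-monoʳ-≤ (p j)
                                (≤1/⇒*≤ {r j} {p j} {P j} 1≤k (proj₂ (numerator j)) (≮⇒≥ r≯1/k)) ⟩
      p j ℕ.+ P j          ≡⟨ ℕ.+-comm (p j) (P j) ⟩
      P j ℕ.+ p j          ∎
      where
      open ℕ.≤-Reasoning
      K : ℕ → ℕ
      K i = ℕ.pred (X ℕ.^ 2 ℕ.^ i)
      X≤X^ : ∀ i → X ℕ.≤ X ℕ.^ 2 ℕ.^ i
      X≤X^ i = ^2^-≥ X i
      1≤K : ∀ i → 1 ℕ.≤ K i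
      1≤K i = ℕ.≤-trans 1≤k (ℕ.pred-mono-≤ (X≤X^ i))
      K+1 : ∀ i → K i ℕ.+ 1 ≡ X ℕ.^ 2 ℕ.^ i
      K+1 i = trans (ℕ.+-comm (K i) 1) (ℕ.suc-pred (X ℕ.^ 2 ℕ.^ i) {{ℕ.m^n≢0 X (2 ℕ.^ i)}})
      K-step : ∀ i → K i ℕ.* (K i ℕ.+ 1) ℕ.≤ K (suc i)
      K-step i = ℕ.+-cancelʳ-≤ 1 _ _ (begin
        K i ℕ.* (K i ℕ.+ 1) ℕ.+ 1                 ≤⟨ ℕ.m≤m+n _ (K i) ⟩
        K i ℕ.* (K i ℕ.+ 1) ℕ.+ 1 ℕ.+ K i         ≡⟨ square (K i) ⟩
        (K i ℕ.+ 1) ℕ.* (K i ℕ.+ 1)               ≡⟨ cong₂ ℕ._*_ (K+1 i) (K+1 i) ⟩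
        X ℕ.^ 2 ℕ.^ i ℕ.* X ℕ.^ 2 ℕ.^ i           ≡⟨ ^2^-suc X i ⟨
        X ℕ.^ 2 ℕ.^ suc i                         ≡⟨ K+1 (suc i) ⟨
        K (suc i) ℕ.+ 1                           ∎)
        where
        square : ∀ x → x ℕ.* (x ℕ.+ 1) ℕ.+ 1 ℕ.+ x ≡ (x ℕ.+ 1) ℕ.* (x ℕ.+ 1)
        square = solve-∀
      -- An excess δ of r j over 1/(X - 1) would survive in every later remainder, against `r→0`.
      r≯1/k : ¬ 1/ k < r j
      r≯1/k 1/k<r = let M , small = r→0 δ 0<δ in
        <-irrefl refl (<-≤-trans (small (j ℕ.+ M) (ℕ.m≤n+m M j))
                                 (≤-trans (x≤x+y δ (1/-nonNeg (K M))) (excess M)))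
        where
        δ : ℚ
        δ = r j - 1/ k
        0<δ : 0ℚ < δ
        0<δ = x<y⇒0<y-x 1/k<r
        -- The excess of r over 1/K is non-decreasing, since
        -- 1/K = 1/(K + 1) + 1/(K (K + 1)).
        excess : ∀ i → δ + 1/ K i ≤ r (j ℕ.+ i)
        excess zero = ≤-reflexive (trans
          (cong (λ x → δ + 1/ x) (cong ℕ.pred (ℕ.^-identityʳ X)))
          (trans (solve 2 (λ x y → x :- y :+ y := x) refl (r j) (1/ k)) (cong r (sym (ℕ.+-identityʳ j)))))
        excess (suc i) = ≤-trans (+-cancelˡ-≤ (1/ (K i ℕ.+ 1)) step) (≤-reflexive (cong r (sym (ℕ.+-suc j i))))
          where
          +-cancelˡ-≤ : ∀ z {x y} → z + x ≤ z + y → x ≤ y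
          +-cancelˡ-≤ z {x} {y} z+x≤z+y =
            ≤-trans (≤-reflexive (undo x)) (≤-trans (+-monoʳ-≤ (- z) z+x≤z+y) (≤-reflexive (sym (undo y))))
            where
            undo : ∀ x → x ≡ - z + (z + x)
            undo x = solve 2 (λ z x → x := :- z :+ (z :+ x)) refl z x
          n : ℕ
          n = j ℕ.+ i
          step : 1/ (K i ℕ.+ 1) + (δ + 1/ K (suc i)) ≤ 1/ (K i ℕ.+ 1) + r (suc n)
          step = ≤-trans
            (+-monoʳ-≤ (1/ (K i ℕ.+ 1)) (+-monoʳ-≤ δ (1/-anti (ℕ.*-mono-≤ (1≤K i) (ℕ.m≤n+m 1 (K i))) (K-step i))))
            (≤-trans (≤-reflexive (trans
                (solve 3 (λ x d y → x :+ (d :+ y) := d :+ (x :+ y))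
                         refl (1/ (K i ℕ.+ 1)) δ (1/ (K i ℕ.* (K i ℕ.+ 1))))
                (cong (δ +_) (sym (1/-split (1≤K i))))))
              (≤-trans (excess i) (≤-trans (≤-reflexive (r-suc n))
                (+-monoˡ-≤ (r (suc n)) (1/-anti (ℕ.m≤n+m 1 (K i)) (ℕ.≤-trans (ℕ.≤-reflexive (K+1 i)) (X^≤a i)))))))

  -- From limits of normalized roots to integer inequalities

  -- Two rationals are produced because `limit-bound` needs strict room: a lower bound q′ on the
  -- roots places q below the limit.
  rational-power-between : ∀ M X Y → 1 ℕ.≤ M → 1 ℕ.≤ X → X ℕ.< Y →
    ∃[ q ] ∃[ q′ ] 0ℚ ≤ q × q < q′ × ι X ≤ q ^ℚ M × q′ ^ℚ M ≤ ι Y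
  rational-power-between M X Y 1≤M 1≤X X<Y with power-between M X Y 1≤M 1≤X X<Y
  ... | k , D , 1≤D , XD≤k , k≤YD =
    frac k , frac (suc k) , 0≤frac ,
    *-monoˡ-<-pos (1/ D) {{positive (1/-pos 1≤D)}} (≰⇒> (λ le → ℕ.<-irrefl refl (ι-cancel-≤ {suc k} {k} le))) ,
    ι≤fraction {frac k ^ℚ M} {k ℕ.^ M} {D ℕ.^ M} {X} 1≤D^M (fraction-^ {frac k} {k} {D} M (frac-eq k)) XD≤k ,
    fraction≤ι {frac (suc k) ^ℚ M} {suc k ℕ.^ M} {D ℕ.^ M} {Y} 1≤D^M
               (fraction-^ {frac (suc k)} {suc k} {D} M (frac-eq (suc k))) k≤YD
    where
    frac : ℕ → ℚ
    frac k = ι k * 1/ D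
    frac-eq : ∀ k → frac k * ι D ≡ ι k
    frac-eq k = trans (*-assoc (ι k) (1/ D) (ι D)) (trans (cong (ι k *_) (1/-inverse 1≤D)) (*-identityʳ (ι k)))
    0≤frac : 0ℚ ≤ frac k
    0≤frac = ≤-trans (≤-reflexive (sym (*-zeroˡ (1/ D))))
                     (*-monoʳ-≤-nonNeg (1/ D) {{nonNegative (1/-nonNeg D)}} (ι-mono-≤ {0} {k} ℕ.z≤n))
    1≤D^M : 1 ℕ.≤ D ℕ.^ M
    1≤D^M = ℕ.m^n>0 D {{ℕ.>-nonZero 1≤D}} M

  ^ℚ-2^-+ : ∀ q m n → q ^ℚ (2 ℕ.^ (m ℕ.+ n)) ≡ (q ^ℚ (2 ℕ.^ m)) ^ℚ (2 ℕ.^ n)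
  ^ℚ-2^-+ q m n = trans (cong (q ^ℚ_) (ℕ.^-distribˡ-+-* 2 m n)) (sym (^-assocʳ q (2 ℕ.^ m) (2 ℕ.^ n)))

  -- If q were not below the liminf, q itself would witness liminf < L. Otherwise membership unfolds
  -- to an index after which all roots exceed q.
  liminf-bound : ExcludedMiddle 0ℓ → ∀ {x : ℕ → ℕ} {L} → ¬ (liminf (normalized x) <ᴿ L) →
                 ∀ {q} → 0ℚ ≤ q → L ∋ q → ∃[ k ] (∀ n → q ^ℚ (2 ℕ.^ (k ℕ.+ n)) ≤ ι (x (k ℕ.+ n)))
  liminf-bound em {x} {L} ≮L {q} 0≤q L∋q with em {liminf (normalized x) ∋ q}
  ... | no  ∌q = ⊥-elim (≮L (q , L∋q , ∌q))
  ... | yes (p , q<p , k , p′ , p<p′ , roots) = k , λ n →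
    let p″ , p′<p″ , _ , p″^≤ = roots n
    in ≤-trans (^ℚ-mono (2 ℕ.^ (k ℕ.+ n)) 0≤q (<⇒≤ (<-trans q<p (<-trans p<p′ p′<p″)))) p″^≤

  -- Were q not below L, then L < q′ and some later root would be below q′, although the hypothesis
  -- puts every rational below q′ under that root.
  limit-bound : ExcludedMiddle 0ℓ → ∀ {x : ℕ → ℕ} {L} → normalized x ⟶ L →
                ∀ {q q′} → 0ℚ ≤ q → q < q′ → ∀ m → (∀ n → q′ ^ℚ (2 ℕ.^ (m ℕ.+ n)) ≤ ι (x (m ℕ.+ n))) → L ∋ q
  limit-bound em {x} {L} x⟶L {q} {q′} 0≤q q<q′ m q′^≤ with em {L ∋ q}
  ... | yes L∋q = L∋q
  ... | no  L∌q =
    let M , above = _⟶_.above x⟶L q′ (q , (q′ , q<q′ , refl) , L∌q)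
        s , (_ , s<q′ , q′≡) , s∉ = above (m ℕ.+ M) (ℕ.m≤n+m M m)
    in ⊥-elim (s∉ (q′ , subst (s <_) q′≡ s<q′ , ≤-trans 0≤q (<⇒≤ q<q′) , q′^≤ M))

  ^ℚ-2^-≤ : ∀ {q X} e n → 0ℚ ≤ q → q ^ℚ (2 ℕ.^ e) ≤ ι X → q ^ℚ (2 ℕ.^ (e ℕ.+ n)) ≤ ι (X ℕ.^ 2 ℕ.^ n)
  ^ℚ-2^-≤ {q} {X} e n 0≤q q^≤X = begin
    q ^ℚ (2 ℕ.^ (e ℕ.+ n))             ≡⟨ ^ℚ-2^-+ q e n ⟩
    (q ^ℚ (2 ℕ.^ e)) ^ℚ (2 ℕ.^ n)      ≤⟨ ^ℚ-mono (2 ℕ.^ n) (^ℚ-nonNeg (2 ℕ.^ e) 0≤q) q^≤X ⟩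
    ι X ^ℚ (2 ℕ.^ n)                   ≡⟨ ι-^ X (2 ℕ.^ n) ⟨
    ι (X ℕ.^ 2 ℕ.^ n)                  ∎
    where open ≤-Reasoning

  ≤-^ℚ-2^ : ∀ {q X} e n → ι X ≤ q ^ℚ (2 ℕ.^ e) → ι (X ℕ.^ 2 ℕ.^ n) ≤ q ^ℚ (2 ℕ.^ (e ℕ.+ n))
  ≤-^ℚ-2^ {q} {X} e n X≤q^ = begin
    ι (X ℕ.^ 2 ℕ.^ n)                  ≡⟨ ι-^ X (2 ℕ.^ n) ⟩
    ι X ^ℚ (2 ℕ.^ n)                   ≤⟨ ^ℚ-mono (2 ℕ.^ n) (ι-mono-≤ {0} {X} ℕ.z≤n) X≤q^ ⟩
    (q ^ℚ (2 ℕ.^ e)) ^ℚ (2 ℕ.^ n)      ≡⟨ ^ℚ-2^-+ q e n ⟨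
    q ^ℚ (2 ℕ.^ (e ℕ.+ n))             ∎
    where open ≤-Reasoning

  -- Choose q < q′ between the 2^e-th roots of X and Y. The roots of b stay at or above q′, so q <
  -- L; hence those of a are eventually above q, and raising to powers gives the bound.
  power-transfer : ExcludedMiddle 0ℓ → ∀ {a b : ℕ → ℕ} {L} → normalized b ⟶ L → ¬ (liminf (normalized a) <ᴿ L) →
                   ∀ e {X Y} → 1 ℕ.≤ X → X ℕ.< Y → (∀ n → Y ℕ.^ 2 ℕ.^ n ℕ.≤ b (e ℕ.+ n)) →
                   ∃[ k ] (∀ n → n ℕ.≥ k → X ℕ.^ 2 ℕ.^ n ℕ.≤ a (e ℕ.+ n))
  power-transfer em {a} {b} {L} b⟶L ≮L e {X} {Y} 1≤X X<Y Y^≤b = proj₁ lower , bound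
    where
    between : ∃[ q ] ∃[ q′ ] 0ℚ ≤ q × q < q′ × ι X ≤ q ^ℚ (2 ℕ.^ e) × q′ ^ℚ (2 ℕ.^ e) ≤ ι Y
    between = rational-power-between (2 ℕ.^ e) X Y (ℕ.m^n>0 2 e) 1≤X X<Y
    q q′ : ℚ
    q  = proj₁ between
    q′ = proj₁ (proj₂ between)
    0≤q : 0ℚ ≤ q
    0≤q = proj₁ (proj₂ (proj₂ between))
    q<q′ : q < q′
    q<q′ = proj₁ (proj₂ (proj₂ (proj₂ between)))
    X≤q^ : ι X ≤ q ^ℚ (2 ℕ.^ e)
    X≤q^ = proj₁ (proj₂ (proj₂ (proj₂ (proj₂ between))))
    q′^≤Y : q′ ^ℚ (2 ℕ.^ e) ≤ ι Y
    q′^≤Y = proj₂ (proj₂ (proj₂ (proj₂ (proj₂ between))))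
    lower : ∃[ k ] (∀ n → q ^ℚ (2 ℕ.^ (k ℕ.+ n)) ≤ ι (a (k ℕ.+ n)))
    lower = liminf-bound em {a} {L} ≮L 0≤q (limit-bound em {b} {L} b⟶L 0≤q q<q′ e (λ n →
      ≤-trans (^ℚ-2^-≤ {q′} {Y} e n (≤-trans 0≤q (<⇒≤ q<q′)) q′^≤Y)
              (ι-mono-≤ {Y ℕ.^ 2 ℕ.^ n} {b (e ℕ.+ n)} (Y^≤b n))))
    bound : ∀ n → n ℕ.≥ proj₁ lower → X ℕ.^ 2 ℕ.^ n ℕ.≤ a (e ℕ.+ n)
    bound n n≥k = ι-cancel-≤ {X ℕ.^ 2 ℕ.^ n} {a (e ℕ.+ n)} (≤-trans (≤-^ℚ-2^ {q} {X} e n X≤q^)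
      (subst (λ l → q ^ℚ (2 ℕ.^ l) ≤ ι (a l)) (ℕ.m+[n∸m]≡n (ℕ.≤-trans n≥k (ℕ.m≤n+m n e)))
             (proj₂ lower (e ℕ.+ n ℕ.∸ proj₁ lower))))

  -- Optimality and growth of the best sequence

  admissible-prefix : ∀ {a} → (∀ n → 2 ℕ.≤ a (suc n)) → (∀ n → a (suc n) ℕ.≤ a (suc (suc n))) →
                      ∀ n → ℰ≤ (prefix a n)
  admissible-prefix {a} 2≤a a-mono n = record
    { 2≤   = λ i → 2≤a (toℕ i)
    ; mono = λ {i} {j} i≤j → subst (λ k → a (suc (toℕ i)) ℕ.≤ a (suc k)) (ℕ.m+[n∸m]≡n i≤j)
                                   (climb (toℕ i) (toℕ j ℕ.∸ toℕ i))
    }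
    where
    climb : ∀ i k → a (suc i) ℕ.≤ a (suc (i ℕ.+ k))
    climb i zero    = ℕ.≤-reflexive (cong (λ j → a (suc j)) (sym (ℕ.+-identityʳ i)))
    climb i (suc k) = ℕ.≤-trans (climb i k)
      (ℕ.≤-trans (a-mono (i ℕ.+ k)) (ℕ.≤-reflexive (cong (λ j → a (suc j)) (sym (ℕ.+-suc i k)))))

  module GreedyBest {lam : ℚ} {b : ℕ → ℕ} (egb : EventuallyGreedyBest lam b) where

    open EventuallyGreedyBest egb
    open Sylvester (T T₀) (λ _ → refl)

    t : ℕ → ℕ
    t = T T₀

    2^≤t : ∀ j → 2 ℕ.^ 2 ℕ.^ j ℕ.≤ t j
    2^≤t j = ℕ.≤-trans (ℕ.^-monoˡ-≤ (2 ℕ.^ j) 2≤T₀) (T-lower 0 j)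

    1≤t : ∀ j → 1 ℕ.≤ t j
    1≤t j = ℕ.≤-trans (ℕ.m^n>0 2 (2 ℕ.^ j)) (2^≤t j)

    -- The greedy denominator t j + 1 splits 1/t j by `1/-split`, so each remainder is the unit
    -- fraction of the next t.
    remainder-at : ∀ j → lam ≡ ∑1/ (prefix b (N ℕ.+ j)) + 1/ t j
    remainder-at zero    = trans remainder (cong (λ n → ∑1/ (prefix b n) + 1/ T₀) (sym (ℕ.+-identityʳ N)))
    remainder-at (suc j) = begin-equality
      lam                                                 ≡⟨ remainder-at j ⟩
      s + 1/ t j                                          ≡⟨ cong (s +_) (1/-split (1≤t j)) ⟩
      s + (1/ (t j ℕ.+ 1) + 1/ t (suc j))                 ≡⟨ +-assoc s _ _ ⟨
      s + 1/ (t j ℕ.+ 1) + 1/ t (suc j)                   ≡⟨ cong (λ x → s + 1/ x + 1/ t (suc j)) (greedy-tail j) ⟨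
      s + 1/ b (suc (N ℕ.+ j)) + 1/ t (suc j)             ≡⟨ cong (_+ 1/ t (suc j)) (∑1/-suc b (N ℕ.+ j)) ⟨
      ∑1/ (prefix b (suc (N ℕ.+ j))) + 1/ t (suc j)       ≡⟨ cong (λ n → ∑1/ (prefix b n) + 1/ t (suc j)) (ℕ.+-suc N j) ⟨
      ∑1/ (prefix b (N ℕ.+ suc j)) + 1/ t (suc j)         ∎
      where
      open ≤-Reasoning
      s : ℚ
      s = ∑1/ (prefix b (N ℕ.+ j))

    -- A largest sum leaves a smallest remainder. The maximizing tuple `d` may differ from the
    -- prefix of b, but only its sum enters.
    1/t≤ : ∀ {c : ℕ → ℕ} j → ℰ≤ (prefix c (N ℕ.+ j)) → ∑1/ (prefix c (N ℕ.+ j)) < lam →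
           1/ t j ≤ lam - ∑1/ (prefix c (N ℕ.+ j))
    1/t≤ {c} j adm below with best (N ℕ.+ j) (ℕ.m≤m+n N j)
    ... | d , maximizing , d≡b = begin
      1/ t j                        ≡⟨ solve 2 (λ s x → x := s :+ x :- s) refl sb (1/ t j) ⟩
      sb + 1/ t j - sb              ≡⟨ cong (_- sb) (remainder-at j) ⟨
      lam - sb                      ≤⟨ +-monoʳ-≤ lam (neg-antimono-≤ (≤-trans
                                         (Maximizing.maximal maximizing (prefix c (N ℕ.+ j)) adm below)
                                         (≤-reflexive d≡b))) ⟩
      lam - ∑1/ (prefix c (N ℕ.+ j)) ∎
      where
      open ≤-Reasoning
      sb : ℚ
      sb = ∑1/ (prefix b (N ℕ.+ j))

    -- b (N + m + 2 + i) exceeds t (m + 1) ^ (2^i), and t (m + 1) > t m ² leaves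
    -- room for the lower bound t m ^ (2^(i + 1)) on a.
    growth : ExcludedMiddle 0ℓ → ∀ {L} → normalized b ⟶ L →
             ∀ {a : ℕ → ℕ} → ¬ (liminf (normalized a) <ᴿ L) →
             ∀ m → ∃[ i₀ ] (∀ i → i ℕ.≥ i₀ → t m ℕ.^ 2 ℕ.^ i ℕ.≤ a (suc (N ℕ.+ (m ℕ.+ i))))
    growth em {L} b⟶L {a} ≮L m = suc (proj₁ transfer) , bound
      where
      open ℕ.≤-Reasoning
      e : ℕ
      -- The index at which b equals t (m + 1) + 1.
      e = suc (N ℕ.+ suc m)
      t^≤b : ∀ n → t (suc m) ℕ.^ 2 ℕ.^ n ℕ.≤ b (e ℕ.+ n)
      t^≤b n = begin
        t (suc m) ℕ.^ 2 ℕ.^ n             ≤⟨ T-lower (suc m) n ⟩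
        t (suc m ℕ.+ n)                   ≤⟨ ℕ.m≤m+n (t (suc m ℕ.+ n)) 1 ⟩
        t (suc m ℕ.+ n) ℕ.+ 1             ≡⟨ greedy-tail (suc m ℕ.+ n) ⟨
        b (suc (N ℕ.+ (suc m ℕ.+ n)))     ≡⟨ cong (λ k → b (suc k)) (ℕ.+-assoc N (suc m) n) ⟨
        b (e ℕ.+ n)                       ∎
      t²<t : t m ℕ.* t m ℕ.< t (suc m)
      t²<t = ℕ.*-monoʳ-< (t m) {{ℕ.>-nonZero (1≤t m)}} (ℕ.m<m+n (t m) (ℕ.s≤s ℕ.z≤n))
      transfer : ∃[ k ] (∀ n → n ℕ.≥ k → (t m ℕ.* t m) ℕ.^ 2 ℕ.^ n ℕ.≤ a (e ℕ.+ n))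
      transfer = power-transfer em {a} {b} {L} b⟶L ≮L e (ℕ.*-mono-≤ (1≤t m) (1≤t m)) t²<t t^≤b
      bound : ∀ i → i ℕ.≥ suc (proj₁ transfer) → t m ℕ.^ 2 ℕ.^ i ℕ.≤ a (suc (N ℕ.+ (m ℕ.+ i)))
      -- One squaring is traded for one index, t m ^ 2^(i + 1) = (t m ²) ^ 2^i, so the threshold
      -- moves up by one.
      bound (suc i) (ℕ.s≤s k≤i) = begin
        t m ℕ.^ 2 ℕ.^ suc i                ≡⟨ ^2^-suc (t m) i ⟩
        t m ℕ.^ 2 ℕ.^ i ℕ.* t m ℕ.^ 2 ℕ.^ i ≡⟨ ^-distribʳ-* (t m) (t m) (2 ℕ.^ i) ⟨
        (t m ℕ.* t m) ℕ.^ 2 ℕ.^ i          ≤⟨ proj₂ transfer i k≤i ⟩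
        a (e ℕ.+ i)                        ≡⟨ cong (λ k → a (suc k)) (index N m i) ⟩
        a (suc (N ℕ.+ (m ℕ.+ suc i)))      ∎
        where
        index : ∀ x y z → x ℕ.+ (1 ℕ.+ y) ℕ.+ z ≡ x ℕ.+ (y ℕ.+ (1 ℕ.+ z))
        index = solve-∀

  -- Comparison of a with the best sequence

  module Comparison
    (em : ExcludedMiddle 0ℓ) {lam : ℚ} (0<lam : 0ℚ < lam)
    {b : ℕ → ℕ} (egb : EventuallyGreedyBest lam b) {L : ℝ̄} (b⟶L : normalized b ⟶ L)
    {a : ℕ → ℕ} (2≤a : ∀ n → 2 ℕ.≤ a (suc n)) (a-mono : ∀ n → a (suc n) ℕ.≤ a (suc (suc n)))
    (a-series : SeriesSum a lam) (≮L : ¬ (liminf (normalized a) <ᴿ L))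
    where

    open EventuallyGreedyBest egb using (N; greedy-tail)
    open GreedyBest egb
    open Series lam 0<lam a 2≤a a-series

    -- The shift by 7 ensures t 7 ≥ 2^2^7, the size that `Residuals` requires of its T 0.
    K : ℕ → ℕ
    K j = N ℕ.+ (7 ℕ.+ j)

    K-suc : ∀ j → K (suc j) ≡ suc (K j)
    K-suc j = ℕ.+-suc N (7 ℕ.+ j)

    -- `growth` is anchored at m; at the later position m + i it serves `tail-bound` with X =
    -- x^(2^i), since x^(2^(i + k)) = X^(2^k).
    tail : ∀ m → ∃[ i₀ ] (∀ i → i ℕ.≥ i₀ →
             p (K (m ℕ.+ i)) ℕ.* t (7 ℕ.+ m) ℕ.^ 2 ℕ.^ i ℕ.≤ P (K (m ℕ.+ i)) ℕ.+ p (K (m ℕ.+ i)))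
    tail m = proj₁ grown , λ i i≥i₀ →
      tail-bound (K (m ℕ.+ i)) (x ℕ.^ 2 ℕ.^ i) (ℕ.≤-trans 2≤x (^2^-≥ x {{ℕ.>-nonZero (1≤t (7 ℕ.+ m))}} i)) (λ k →
        subst₂ ℕ._≤_ (power i k) (cong (λ n → a (suc n)) (index i k))
               (proj₂ grown (i ℕ.+ k) (ℕ.≤-trans i≥i₀ (ℕ.m≤m+n i k))))
      where
      grown : ∃[ i₀ ] (∀ i → i ℕ.≥ i₀ → t (7 ℕ.+ m) ℕ.^ 2 ℕ.^ i ℕ.≤ a (suc (N ℕ.+ (7 ℕ.+ m ℕ.+ i))))
      grown = growth em {L} b⟶L {a} ≮L (7 ℕ.+ m)
      x : ℕ
      x = t (7 ℕ.+ m)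
      2≤x : 2 ℕ.≤ x
      2≤x = ℕ.≤-trans (^2^-≥ 2 (7 ℕ.+ m)) (2^≤t (7 ℕ.+ m))
      power : ∀ i k → x ℕ.^ 2 ℕ.^ (i ℕ.+ k) ≡ (x ℕ.^ 2 ℕ.^ i) ℕ.^ 2 ℕ.^ k
      power i k = trans (cong (x ℕ.^_) (ℕ.^-distribˡ-+-* 2 i k)) (sym (ℕ.^-*-assoc x (2 ℕ.^ i) (2 ℕ.^ k)))
      index : ∀ i k → K (m ℕ.+ (i ℕ.+ k)) ≡ K (m ℕ.+ i) ℕ.+ k
      index i k = lemma N m i k
        where
        lemma : ∀ n m i k → n ℕ.+ (7 ℕ.+ (m ℕ.+ (i ℕ.+ k))) ≡ n ℕ.+ (7 ℕ.+ (m ℕ.+ i)) ℕ.+ k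
        lemma = solve-∀

    greedy : ∃[ n₀ ] (∀ j → j ℕ.≥ n₀ → a (suc (K j)) ≡ t (7 ℕ.+ j) ℕ.+ 1)
    greedy = Residuals.eventually-greedy em (λ j → t (7 ℕ.+ j)) (λ _ → refl) (2^≤t 7)
      (λ j → a (suc (K j))) (λ j → p (K j)) (λ j → P (K j))
      (λ j → 1≤p (K j)) (λ j → 1≤P (K j))
      (λ j → cong P (K-suc j))
      (λ j → trans (cong (λ n → p n ℕ.+ P (K j)) (K-suc j)) (p-suc (K j)))
      -- The bound P ≤ p T is where the optimality of b enters.
      (λ j → 1/≤⇒≤* {r (K j)} {p (K j)} {P (K j)} (1≤t (7 ℕ.+ j)) (proj₂ (numerator (K j)))
               (1/t≤ {a} (7 ℕ.+ j) (admissible-prefix {a} 2≤a a-mono (K j)) (S<lam (K j))))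
      tail

    agree : Eventually (λ n → a n ≡ b n)
    agree = suc (K 0) ℕ.+ proj₁ greedy , λ n n≥ → subst (λ n → a n ≡ b n) (index n n≥)
      (trans (proj₂ greedy (j n) (j≥ n n≥)) (sym (greedy-tail (7 ℕ.+ j n))))
      where
      j : ℕ → ℕ
      j n = n ℕ.∸ suc (K 0)
      j≥ : ∀ n → n ℕ.≥ suc (K 0) ℕ.+ proj₁ greedy → j n ℕ.≥ proj₁ greedy
      j≥ n n≥ = ℕ.≤-trans (ℕ.≤-reflexive (sym (ℕ.m+n∸m≡n (suc (K 0)) (proj₁ greedy))))
                          (ℕ.∸-monoˡ-≤ (suc (K 0)) n≥)
      index : ∀ n → n ℕ.≥ suc (K 0) ℕ.+ proj₁ greedy → suc (K (j n)) ≡ n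
      index n n≥ = trans (lemma N (j n)) (ℕ.m+[n∸m]≡n (ℕ.≤-trans (ℕ.m≤m+n (suc (K 0)) (proj₁ greedy)) n≥))
        where
        lemma : ∀ x y → 1 ℕ.+ (x ℕ.+ (7 ℕ.+ y)) ≡ 1 ℕ.+ (x ℕ.+ 7) ℕ.+ y
        lemma = solve-∀

-- The dichotomy, by excluded middle on the liminf inequality

open Rationals using (module Comparison)
open import Data.Nat using (ℕ; zero; suc; _≤_; s≤s; z≤n)
open import Data.Nat.Properties using (≤-trans)
open import Data.Rational using (ℚ; 0ℚ; _<_)
open import Data.Sum using (_⊎_; inj₁; inj₂)

theorem4 : ExcludedMiddle 0ℓ →
    (lam : ℚ) → 0ℚ < lam →
    (b : ℕ → ℕ) → EventuallyGreedyBest lam b →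
    (L : ℝ̄) → normalized b ⟶ L →
    (a : ℕ → ℕ) → 2 ≤ a 1 → (∀ n → 1 ≤ n → a n ≤ a (suc n)) →
    SeriesSum a lam →
    (liminf (normalized a) <ᴿ L) ⊎ Eventually (λ n → a n ≡ b n)
theorem4 em lam 0<lam b egb L b⟶L a 2≤a₁ a-mono a-series = case em of λ where
    (yes <L) → inj₁ <L
    (no  ≮L) → inj₂ (Comparison.agree em 0<lam egb b⟶L 2≤a (λ n → a-mono (suc n) (s≤s z≤n)) a-series ≮L)
  where
  2≤a : ∀ n → 2 ≤ a (suc n)
  2≤a zero    = 2≤a₁
  2≤a (suc n) = ≤-trans (2≤a n) (a-mono (suc n) (s≤s z≤n))
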